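{- Given $0<\varepsilon<\frac12$ and $\sigma>0$, there exists a constant $c>0$ such that the following holds. Let $G$ be a tournament on $N$ vertices which is $(\varepsilon,\sigma\log N)$-pseudorandom. Then $G\to(\vec P_n,T)$ for every directed tree $T$ on $m$ vertices with at most $m^{1/6}$ leaves, provided $n,m\le N/c$ and $nm\le\frac{N^2}{c^2\log N}$.
   Context: An oriented graph $G$ is $(\varepsilon,k)$-pseudorandom if for all disjoint $A,B\subseteq V(G)$ with $|A|,|B|\ge k$, at least $\varepsilon|A||B|$ edges are directed from $A$ to $B$. A tournament is an orientation of a complete graph. $\vec P_n$ is the directed path on $n$ vertices. A directed tree is an oriented tree in which there is a vertex (the root) such that all edges are directed away from it (out-directed) or all are directed towards it (in-directed). Leaves are vertices of degree $1$ in the underlying tree. $G\to(H,K)$ means every red/blue edge-colouring of $G$ contains a blue copy of $H$ or a red copy of $K$ (as oriented subgraphs). Logarithms are base $2$. -}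

module Defs where

open import Data.Nat using (ℕ; zero; suc; _+_; _*_; _^_; _≤_)
open import Data.Fin using (Fin; toℕ)
import Data.Fin as Fin
open import Data.Bool using (Bool; true; false; _∧_; _∨_; _xor_; if_then_else_)
open import Data.Product using (Σ; _×_; ∃; ∃-syntax)
open import Data.Sum using (_⊎_)
open import Data.Integer using (+_; ∣_∣)
open import Data.Rational using (ℚ; ↥_; ↧ₙ_; _/_) renaming (_≤_ to _≤ℚ_; _*_ to _*ℚ_)
open import Relation.Binary.PropositionalEquality using (_≡_; _≢_)
open import Relation.Nullary using (¬_)
open import Function.Definitions using (Injective)

countB : {k : ℕ} → (Fin k → Bool) → ℕ
countB {zero}  p = 0
countB {suc k} p = (if p Fin.zero then 1 else 0) + countB (λ i → p (Fin.suc i))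

Digraph : ℕ → Set
Digraph N = Fin N → Fin N → Bool

IsTournament : {N : ℕ} → Digraph N → Set
IsTournament {N} G =
  ((i : Fin N) → G i i ≡ false) ×
  ((i j : Fin N) → i ≢ j → (G i j xor G j i) ≡ true)

Disjoint : {N : ℕ} → (Fin N → Bool) → (Fin N → Bool) → Set
Disjoint {N} A B = (x : Fin N) → (A x ∧ B x) ≡ false

eDir : {N : ℕ} → Digraph N → (Fin N → Bool) → (Fin N → Bool) → ℕ
eDir G A B = sumF (λ a → countB (λ b → A a ∧ (B b ∧ G a b)))
  where
  sumF : {k : ℕ} → (Fin k → ℕ) → ℕ
  sumF {zero} f = 0
  sumF {suc k} f = f Fin.zero + sumF (λ i → f (Fin.suc i))

-- AtLeastσLog σ N a  means  a ≥ σ · log₂ N  (real logarithm), for σ > 0 and N ≥ 1.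
-- Writing σ = p/q (p = ↥σ > 0, q = ↧σ), this is  q·a ≥ p·log₂ N,  i.e.  N^p ≤ 2^(q·a).
AtLeastσLog : ℚ → ℕ → ℕ → Set
AtLeastσLog σ N a = N ^ ∣ ↥ σ ∣ ≤ 2 ^ (↧ₙ σ * a)

ℕtoℚ : ℕ → ℚ
ℕtoℚ n = (+ n) / 1

Pseudorandom : {N : ℕ} → ℚ → ℚ → Digraph N → Set
Pseudorandom {N} ε σ G =
  (A B : Fin N → Bool) → Disjoint A B →
  AtLeastσLog σ N (countB A) → AtLeastσLog σ N (countB B) →
  (ε *ℚ ℕtoℚ (countB A * countB B)) ≤ℚ ℕtoℚ (eDir G A B)

Und : {m : ℕ} → Digraph m → Fin m → Fin m → Bool
Und T u v = T u v ∨ T v u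

IsOriented : {m : ℕ} → Digraph m → Set
IsOriented {m} T = ((u : Fin m) → T u u ≡ false) × ((u v : Fin m) → (T u v ∧ T v u) ≡ false)

data UWalk {m : ℕ} (T : Digraph m) : Fin m → Fin m → Set where
  here  : (u : Fin m) → UWalk T u u
  there : {u w v : Fin m} → Und T u w ≡ true → UWalk T w v → UWalk T u v

data DWalk {m : ℕ} (T : Digraph m) : Fin m → Fin m → Set where
  here  : (u : Fin m) → DWalk T u u
  there : {u w v : Fin m} → T u w ≡ true → DWalk T w v → DWalk T u v

Connected : {m : ℕ} → Digraph m → Set
Connected {m} T = (u v : Fin m) → UWalk T u v

HasCycle : {m : ℕ} → Digraph m → Set
HasCycle {m} T =
  ∃[ k ] Σ (Fin (suc (suc (suc k))) → Fin m) λ c →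
    Injective _≡_ _≡_ c ×
    ((i j : Fin (suc (suc (suc k)))) →
       (toℕ j ≡ suc (toℕ i) ⊎ (toℕ i ≡ suc (suc k) × toℕ j ≡ 0)) →
       Und T (c i) (c j) ≡ true)

IsOrientedTree : {m : ℕ} → Digraph m → Set
IsOrientedTree {m} T = (1 ≤ m) × IsOriented T × Connected T × ¬ HasCycle T

-- directed tree: some root r with all arcs directed away from r (every vertex reachable
-- from r by a directed path) or all towards r (r reachable from every vertex)
IsDirectedTree : {m : ℕ} → Digraph m → Set
IsDirectedTree {m} T = IsOrientedTree T ×
  (∃[ r ] (((v : Fin m) → DWalk T r v) ⊎ ((v : Fin m) → DWalk T v r)))

degree : {m : ℕ} → Digraph m → Fin m → ℕ
degree T u = countB (λ v → Und T u v)

isOne : ℕ → Bool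
isOne (suc zero) = true
isOne _ = false

leaves : {m : ℕ} → Digraph m → ℕ
leaves T = countB (λ u → isOne (degree T u))

data Colour : Set where
  red blue : Colour

Colouring : ℕ → Set
Colouring N = Fin N → Fin N → Colour

PathCopy : {N : ℕ} → Digraph N → Colouring N → Colour → ℕ → Set
PathCopy {N} G col χ n = Σ (Fin n → Fin N) λ f → Injective _≡_ _≡_ f ×
  ((i j : Fin n) → toℕ j ≡ suc (toℕ i) → (G (f i) (f j) ≡ true) × (col (f i) (f j) ≡ χ))

Copy : {N m : ℕ} → Digraph N → Colouring N → Colour → Digraph m → Set
Copy {N} {m} G col χ T = Σ (Fin m → Fin N) λ g → Injective _≡_ _≡_ g ×
  ((u v : Fin m) → T u v ≡ true → (G (g u) (g v) ≡ true) × (col (g u) (g v) ≡ χ))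

Arrows : {N m : ℕ} → Digraph N → ℕ → Digraph m → Set
Arrows {N} G n T = (col : Colouring N) → PathCopy G col blue n ⊎ Copy G col red T

module Submission where

-- Let k be of order log N, so that there is an edge from A to B whenever |A|, |B| ≥ k.  Search the
-- blue edges depth first, order the vertices by finishing time, and let h v be the length of a
-- longest blue path that ends at v and descends in this order.  If u is finished before v and there
-- is a blue edge from v to u, then h v < h u; if there is one from u to v, then v is an ancestor of
-- everything finished from u on until v, so all these vertices have larger h than v.  Without a
-- blue path on n vertices h takes fewer than n values.
--
-- Cut the order into t blocks of 22 k vertices and the heights into classes of width
-- w ≈ n / t.  If a block has many vertices above and many below some class, it is matched with
-- another block of that class: the high vertices X of the later block and the low vertices Y of
-- the earlier block span no blue edge at all, hence contain long red zigzag paths.  Otherwise the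
-- block lies mostly within one class; dropping the at most w vertices that receive a blue edge
-- from earlier blocks, each of its large subsets has a large level set of h, which is a red
-- tournament and contains a red path on ℓ ≈ k / w vertices.  In either case every vertex in an
-- earlier block sends no blue edge to one of the (one or two) sides of such a unit.  Hence, in
-- order, units can be linked by red edges between any sets of at least k vertices, and T, cut into
-- at most m / ℓ + O(leaves) paths of at most ℓ vertices, is embedded from its leaves towards its
-- root, one unit for each path, plus one more unit for each child.  A tree directed towards its root
-- is treated by reversing all edges.

open import Defs
open import Data.Nat using (ℕ; zero; suc; _+_; _*_; _^_; _∸_; _/_; _%_; _≤_; _<_; z≤n; s≤s; s≤s⁻¹; _≤?_; _<?_; NonZero; >-nonZero)
import Data.Nat as ℕ
open import Data.Nat.Properties
open import Data.Nat.DivMod using (m/n*n≤m; m≡m%n+[m/n]*n; m%n<n; m≥n⇒m/n>0)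
open import Data.Nat.Tactic.RingSolver using (solve-∀)
open import Data.Bool using (Bool; true; false; _∧_; _xor_; if_then_else_)
import Data.Bool as Bool
open import Data.Fin using (Fin; zero; suc; toℕ)
import Data.Fin as Fin
import Data.Fin.Properties as Finₚ
open import Data.Integer using (∣_∣; +[1+_])
open import Data.Rational using (ℚ; 0ℚ; ½; ↥_; ↧ₙ_; mkℚ; positive) renaming (_<_ to _<ℚ_; _≤_ to _≤ℚ_; _*_ to _*ℚ_)
import Data.Rational.Properties as ℚₚ
open import Data.Product using (_×_; _,_; proj₁; proj₂; ∃-syntax)
open import Data.Sum as Sum using (_⊎_; inj₁; inj₂; [_,_]′)
open import Data.Unit using (⊤; tt)
open import Data.Empty using (⊥; ⊥-elim)
open import Data.List using (List; []; _∷_; _++_; length; map; filter; concat; upTo; take; drop; reverse; lookup; allFin; _ʳ++_)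
open import Data.List.Properties using (length-++; length-map; length-upTo; length-take; length-drop; length-reverse; length-tabulate; filter-all; filter-none; filter-++; filter-accept; filter-reject; take++drop≡id; map-++) renaming (++-identityʳ to ++-idʳ)
open import Data.List.Relation.Unary.All as All using (All; []; _∷_)
import Data.List.Relation.Unary.All.Properties as Allₚ
open import Data.List.Relation.Unary.Any as Any using (Any; here; there)
import Data.List.Relation.Unary.Any.Properties as Anyₚ
open import Data.List.Relation.Unary.AllPairs as AllPairs using (AllPairs; []; _∷_)
import Data.List.Relation.Unary.AllPairs.Properties as AllPairsₚ
open import Data.List.Relation.Unary.Linked as Linked using (Linked; []; [-]; _∷_)
open import Data.List.Relation.Unary.Unique.Propositional using (Unique)
import Data.List.Relation.Unary.Unique.Propositional.Properties as Uniqueₚ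
open import Data.List.Membership.Propositional using (_∈_; _∉_; find; lose)
open import Data.List.Membership.Propositional.Properties using (∈-++⁺ˡ; ∈-++⁺ʳ; ∈-++⁻; ∈-∃++; ∈-filter⁺; ∈-filter⁻; ∈-upTo⁺; ∈-upTo⁻; ∈-map⁺; ∈-map⁻; ∈-lookup; ∈-allFin)
open import Data.List.Relation.Binary.Subset.Propositional using (_⊆_)
open import Data.List.Relation.Binary.Disjoint.Propositional using () renaming (Disjoint to Disjointₗ)
open import Data.List.Relation.Binary.Permutation.Propositional using (_↭_; ↭-refl; ↭-sym; ↭-trans; ↭-reflexive; ↭⇒↭ₛ; prep; ↭-swap)
import Data.List.Relation.Binary.Permutation.Setoid.Properties as Permutationₛ
open import Data.List.Relation.Binary.Permutation.Propositional.Properties using (All-resp-↭; ∈-resp-↭; ↭-length; ↭-reverse; ++⁺ˡ; ++⁺ʳ; shift; ++-assoc; ++-identityʳ; map⁺)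
open import Function using (_∘_; id; flip; case_of_; _on_)
open import Relation.Binary.Definitions using (DecidableEquality; tri<; tri≈; tri>) renaming (Decidable to Decidable₂)
open import Relation.Binary.PropositionalEquality using (_≡_; _≢_; refl; sym; trans; cong; cong₂; subst; subst₂)
open import Relation.Binary.PropositionalEquality.Properties using (setoid)
open import Relation.Nullary using (¬_; Dec; yes; no; ¬?; contradiction)
open import Relation.Nullary.Decidable using (_×-dec_; _⊎-dec_; decidable-stable; does; dec-true; toSum)
open import Relation.Unary using (Decidable)

-- Lists without repetitions

unique-⊆-length : {A : Set} {xs ys : List A} → Unique xs → xs ⊆ ys → length xs ≤ length ys
unique-⊆-length [] _ = z≤n
unique-⊆-length {xs = x ∷ xs} (x∉ ∷ u) sub with ∈-∃++ (sub (here refl))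
... | as , bs , refl = subst (suc (length xs) ≤_) eq (s≤s (unique-⊆-length u sub′))
  where
  eq : suc (length (as ++ bs)) ≡ length (as ++ x ∷ bs)
  eq = sym (↭-length (shift x as bs))
  sub′ : xs ⊆ as ++ bs
  sub′ {z} z∈ with ∈-resp-↭ (shift x as bs) (sub (there z∈))
  ... | here refl = contradiction refl (All.lookup x∉ z∈)
  ... | there z∈′ = z∈′

unique-bounded-length : {n : ℕ} {xs : List ℕ} → Unique xs → All (_< n) xs → length xs ≤ n
unique-bounded-length {n} u b = subst (_ ≤_) (length-upTo n) (unique-⊆-length u (λ x∈ → ∈-upTo⁺ (All.lookup b x∈)))

module _ {A : Set} where

  unique-resp-↭ : {xs ys : List A} → xs ↭ ys → Unique xs → Unique ys
  unique-resp-↭ p = Permutationₛ.Unique-resp-↭ (setoid A) (↭⇒↭ₛ p)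

  AllPairs-++⁻ : {R : A → A → Set} (xs : List A) {ys : List A} → AllPairs R (xs ++ ys) →
                 AllPairs R xs × AllPairs R ys × All (λ x → All (R x) ys) xs
  AllPairs-++⁻ [] r = [] , r , []
  AllPairs-++⁻ (x ∷ xs) (a ∷ r) with AllPairs-++⁻ xs r | Allₚ.++⁻ xs a
  ... | rx , ry , rxy | ax , ay = ax ∷ rx , ry , ay ∷ rxy

  AllPairs-map∈ : {R S : A → A → Set} {xs : List A} → (∀ {x y} → x ∈ xs → y ∈ xs → R x y → S x y) →
                  AllPairs R xs → AllPairs S xs
  AllPairs-map∈ f [] = []
  AllPairs-map∈ f (a ∷ r) =
    All.tabulate (λ y∈ → f (here refl) (there y∈) (All.lookup a y∈)) ∷
    AllPairs-map∈ (λ x∈ y∈ → f (there x∈) (there y∈)) r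

  AllPairs-all : {R : A → A → Set} {xs : List A} → (∀ {x y} → x ∈ xs → y ∈ xs → R x y) → AllPairs R xs
  AllPairs-all {xs = []} f = []
  AllPairs-all {xs = x ∷ xs} f =
    All.tabulate (λ y∈ → f (here refl) (there y∈)) ∷ AllPairs-all (λ x∈ y∈ → f (there x∈) (there y∈))

  AllTriples : (A → A → A → Set) → List A → Set
  AllTriples P [] = ⊤
  AllTriples P (x ∷ xs) = AllPairs (P x) xs × AllTriples P xs

  AllTriples-++⁺ : {P : A → A → A → Set} {xs ys : List A} → AllTriples P xs → AllTriples P ys →
    All (λ x → AllPairs (P x) ys) xs → AllPairs (λ x z → All (P x z) ys) xs → AllTriples P (xs ++ ys)
  AllTriples-++⁺ {xs = []} _ t _ _ = t
  AllTriples-++⁺ {xs = x ∷ xs} (p , t) t′ (a ∷ as) (b ∷ bs) =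
    AllPairsₚ.++⁺ p a b , AllTriples-++⁺ t t′ as bs

  AllTriples-++⁻ : {P : A → A → A → Set} (xs : List A) {ys : List A} → AllTriples P (xs ++ ys) →
    All (λ x → AllPairs (P x) ys) xs
  AllTriples-++⁻ [] _ = []
  AllTriples-++⁻ (x ∷ xs) (p , t) = proj₁ (proj₂ (AllPairs-++⁻ xs p)) ∷ AllTriples-++⁻ xs t

  extract : {P : A → Set} {xs : List A} → Any P xs → ∃[ w ] ∃[ ys ] (P w × xs ↭ w ∷ ys)
  extract a with find a
  ... | w , w∈ , pw with ∈-∃++ w∈
  ... | as , bs , refl = w , as ++ bs , pw , shift w as bs

-- A forest is stored as (root of the first tree, its children, the later trees), and flat lists
-- the vertices in the order in which a depth-first search finishes them.
data Forest (A : Set) : Set where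
  empty : Forest A
  node  : A → Forest A → Forest A → Forest A

flat : {A : Set} → Forest A → List A
flat empty = []
flat (node w c s) = flat c ++ w ∷ flat s

-- Depth-first search, finishing order and heights

module DepthFirst {A : Set} (E : A → A → Set) (E? : Decidable₂ E) where

  NoEdges : List A → List A → Set
  NoEdges xs ys = All (λ x → All (λ y → ¬ E x y) ys) xs

  -- Here `p` says which vertices may be entered next: those adjacent from the parent. The last
  -- field of `node` holds because the search leaves a subtree only when no edge from it leads to an
  -- unvisited vertex.
  data Search (p : A → Set) : Forest A → Set where
    empty : Search p empty
    node  : ∀ {w c s} → p w → Search (E w) c → Search p s →
            NoEdges (w ∷ flat c) (flat s) → Search p (node w c s)

  -- `k` is fuel: `w` is taken out before both recursive calls. What the search below `w` leaves
  -- over is searched for further siblings of `w`.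
  search : (p : A → Set) → Decidable p → (k : ℕ) (xs : List A) → length xs ≤ k →
           ∃[ F ] ∃[ rest ] (Search p F × xs ↭ flat F ++ rest × All (¬_ ∘ p) rest × NoEdges (flat F) rest)
  search p p? k xs len with Any.any? p? xs
  ... | no ¬a = empty , xs , empty , ↭-refl , Allₚ.¬Any⇒All¬ xs ¬a , []
  ... | yes a with extract a
  search p p? zero xs len | yes a | w , ys , pw , perm =
    contradiction (subst (_≤ 0) (↭-length perm) len) λ ()
  search p p? (suc k) xs len | yes a | w , ys , pw , perm
    with search (E w) (E? w) k ys (s≤s⁻¹ (subst (_≤ suc k) (↭-length perm) len))
  ... | c , rest₁ , sc , perm₁ , no₁ , edges₁
    with search p p? k rest₁ (≤-trans (subst (length rest₁ ≤_)
           (sym (trans (↭-length perm₁) (length-++ (flat c)))) (m≤n+m _ _))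
           (s≤s⁻¹ (subst (_≤ suc k) (↭-length perm) len)))
  ... | s , rest₂ , ss , perm₂ , no₂ , edges₂ =
    node w c s , rest₂ , node pw sc ss sideways , perm′ , no₂ , Allₚ.++⁺ below (here₂ ∷ edges₂)
    where
    split : {P : A → Set} → All P rest₁ → All P (flat s) × All P rest₂
    split a = Allₚ.++⁻ (flat s) (All-resp-↭ perm₂ a)
    sideways : NoEdges (w ∷ flat c) (flat s)
    sideways = proj₁ (split no₁) ∷ All.map (proj₁ ∘ split) edges₁
    below : NoEdges (flat c) rest₂
    below = All.map (proj₂ ∘ split) edges₁
    here₂ : All (λ y → ¬ E w y) rest₂
    here₂ = proj₂ (split no₁)
    perm′ : xs ↭ (flat c ++ w ∷ flat s) ++ rest₂
    perm′ = ↭-trans perm (↭-trans (prep w (↭-trans perm₁ (++⁺ˡ (flat c) perm₂)))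
      (↭-trans (↭-sym (shift w (flat c) (flat s ++ rest₂))) (↭-sym (++-assoc (flat c) (w ∷ flat s) rest₂))))

  argmax : {P : A → Set} → Decidable P → (h : A → ℕ) (xs : List A) →
           All (¬_ ∘ P) xs ⊎ (∃[ y ] (y ∈ xs × P y × (∀ {z} → z ∈ xs → P z → h z ≤ h y)))
  argmax P? h [] = inj₁ []
  argmax P? h (x ∷ xs) with P? x | argmax P? h xs
  ... | no ¬p | inj₁ none = inj₁ (¬p ∷ none)
  ... | no ¬p | inj₂ (y , y∈ , py , max) = inj₂ (y , there y∈ , py ,
    λ { (here refl) pz → contradiction pz ¬p ; (there z∈) pz → max z∈ pz })
  ... | yes p | inj₁ none = inj₂ (x , here refl , p ,
    λ { (here refl) _ → ≤-refl ; (there z∈) pz → contradiction pz (All.lookup none z∈) })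
  ... | yes p | inj₂ (y , y∈ , py , max) with h x ≤? h y
  ... | yes le = inj₂ (y , there y∈ , py , λ { (here refl) _ → le ; (there z∈) pz → max z∈ pz })
  ... | no nle = inj₂ (x , here refl , p ,
    λ { (here refl) _ → ≤-refl ; (there z∈) pz → ≤-trans (max z∈ pz) (<⇒≤ (≰⇒> nle)) })

  -- The path is listed from its end `v` backwards, and `h v` counts its edges.
  PathTo : (A → ℕ) → List A → A → Set
  PathTo h xs v = ∃[ q ] (length q ≡ h v × Linked (flip E) (v ∷ q) × Unique (v ∷ q) × All (_∈ xs) (v ∷ q))

  -- Built from the back of the list: the head `x` gets one more than the largest height among the
  -- later `y` with an edge to `x`, or 0 if there is none, and prolongs the path that witnesses it.
  heights : DecidableEquality A → (xs : List A) → Unique xs →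
            ∃[ h ] (AllPairs (λ x y → E y x → h y < h x) xs × (∀ {v} → v ∈ xs → PathTo h xs v))
  heights _≟_ [] _ = (λ _ → 0) , [] , λ ()
  heights _≟_ (x ∷ xs) (x∉ ∷ u) with heights _≟_ xs u
  ... | h , mono , paths = h′ , All.tabulate x-mono ∷ AllPairs-map∈ old-mono mono , paths′
    where
    best = argmax (λ y → E? y x) h xs
    top : ℕ
    top = [ (λ _ → 0) , (λ { (y , _) → suc (h y) }) ]′ best
    h′ : A → ℕ
    h′ v with v ≟ x
    ... | yes _ = top
    ... | no _ = h v
    h′-new : h′ x ≡ top
    h′-new with x ≟ x
    ... | yes _ = refl
    ... | no ne = contradiction refl ne
    h′-old : ∀ {v} → v ∈ xs → h′ v ≡ h v
    h′-old {v} v∈ with v ≟ x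
    ... | yes refl = contradiction refl (All.lookup x∉ v∈)
    ... | no _ = refl
    below-top : ∀ {y} → y ∈ xs → E y x → h y < top
    below-top y∈ e with best
    ... | inj₁ none = contradiction e (All.lookup none y∈)
    ... | inj₂ (_ , _ , _ , max) = s≤s (max y∈ e)
    x-mono : ∀ {y} → y ∈ xs → E y x → h′ y < h′ x
    x-mono y∈ e = subst₂ _<_ (sym (h′-old y∈)) (sym h′-new) (below-top y∈ e)
    old-mono : ∀ {y z} → y ∈ xs → z ∈ xs → (E z y → h z < h y) → E z y → h′ z < h′ y
    old-mono y∈ z∈ f e = subst₂ _<_ (sym (h′-old z∈)) (sym (h′-old y∈)) (f e)
    top-path : ∃[ q ] (length q ≡ top × Linked (flip E) (x ∷ q) × Unique (x ∷ q) × All (_∈ (x ∷ xs)) (x ∷ q))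
    top-path with best
    ... | inj₁ _ = [] , refl , [-] , ([] ∷ []) , (here refl ∷ [])
    ... | inj₂ (y , y∈ , e , _) with paths y∈
    ... | q , len , link , uq , inside =
      y ∷ q , cong suc len , e ∷ link , All.map (λ z∈ → λ { refl → All.lookup x∉ z∈ refl }) inside ∷ uq ,
      here refl ∷ All.map there inside
    paths′ : ∀ {v} → v ∈ x ∷ xs → PathTo h′ (x ∷ xs) v
    paths′ (here refl) with top-path
    ... | q , len , rest = q , trans len (sym h′-new) , rest
    paths′ (there v∈) with paths v∈
    ... | q , len , link , uq , inside = q , trans len (sym (h′-old v∈)) , link , uq , All.map there inside

  module _ (h : A → ℕ) where

    Forward Pair : A → A → Set
    Forward x y = E y x → h y < h x
    Pair x y = E x y ⊎ E y x → h y < h x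

    Triple : A → A → A → Set
    Triple x z y = E x y → h y < h z

    -- The edge from `w` to a child, which finishes earlier, makes the child higher by `Forward`;
    -- the rest follows by descending the search tree.
    children-above : ∀ {w c} → Search (E w) c → AllPairs Forward (flat c ++ w ∷ []) → All (λ x → h w < h x) (flat c)
    children-above empty _ = []
    children-above {w} (node {w′} {c} {s} e sc ss _) fw
      with AllPairs-++⁻ (flat c ++ w′ ∷ flat s) fw
    ... | fw′ , _ , last with AllPairs-++⁻ (flat c) fw′ | Allₚ.++⁻ (flat c) last
    ... | fc , (_ ∷ fs) , cross | _ , (lw′ ∷ ls) =
      Allₚ.++⁺ (All.map (<-trans w<w′) (children-above sc
        (AllPairsₚ.++⁺ fc ([] ∷ []) (All.map (λ { (a ∷ _) → a ∷ [] }) cross))))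
        (w<w′ ∷ children-above ss (AllPairsₚ.++⁺ fs ([] ∷ []) ls))
      where
      w<w′ : h w < h w′
      w<w′ = All.head lw′ e

    -- An edge from `x` to a later finished `y` can only lead to an ancestor of `x`, as no edge goes
    -- from a finished subtree to a later sibling tree. Everything between `x` and `y` then lies
    -- below `y` too, and `children-above` applies. Edges in the other direction are covered by
    -- `Forward`.
    search-order : ∀ {p F} → Search p F → AllPairs Forward (flat F) →
                   AllPairs Pair (flat F) × AllTriples Triple (flat F)
    search-order empty _ = [] , tt
    search-order (node {w} {c} {s} _ sc ss none) fw with AllPairs-++⁻ (flat c) fw
    ... | fc , (fw-s ∷ fs) , cross with search-order sc fc | search-order ss fs
    ... | pc , tc | ps , ts =
      AllPairsₚ.++⁺ pc (pair-w ∷ ps) (All.tabulate pair-c) ,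
      AllTriples-++⁺ tc (triple-w , ts) (All.tabulate triple-c) (AllPairs-all triple-cc)
      where
      above : All (λ x → h w < h x) (flat c)
      above = children-above sc (AllPairsₚ.++⁺ fc ([] ∷ []) (All.map (λ { (a ∷ _) → a ∷ [] }) cross))
      none-w = All.head none
      none-c = All.tail none
      pair-w : All (Pair w) (flat s)
      pair-w = All.tabulate λ y∈ → [ (λ e → contradiction e (All.lookup none-w y∈)) , All.lookup fw-s y∈ ]′
      pair-c : ∀ {x} → x ∈ flat c → All (Pair x) (w ∷ flat s)
      pair-c x∈ = (λ _ → All.lookup above x∈) ∷ All.tabulate λ y∈ →
        [ (λ e → contradiction e (All.lookup (All.lookup none-c x∈) y∈)) , All.lookup (All.tail (All.lookup cross x∈)) y∈ ]′
      triple-w : AllPairs (Triple w) (flat s)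
      triple-w = AllPairs-all λ _ y∈ e → contradiction e (All.lookup none-w y∈)
      triple-c : ∀ {x} → x ∈ flat c → AllPairs (Triple x) (w ∷ flat s)
      triple-c x∈ = All.tabulate (λ y∈ e → contradiction e (All.lookup (All.lookup none-c x∈) y∈)) ∷
        AllPairs-all λ _ y∈ e → contradiction e (All.lookup (All.lookup none-c x∈) y∈)
      triple-cc : ∀ {x z} → x ∈ flat c → z ∈ flat c → All (Triple x z) (w ∷ flat s)
      triple-cc x∈ z∈ = (λ _ → All.lookup above z∈) ∷
        All.tabulate λ y∈ e → contradiction e (All.lookup (All.lookup none-c x∈) y∈)

  record Ordering (xs : List A) : Set where
    field
      ord : List A
      perm : ord ↭ xs
      h : A → ℕ
      pairs : AllPairs (Pair h) ord
      triples : AllTriples (Triple h) ord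
      paths : ∀ {v} → v ∈ ord → PathTo h ord v

  ordering : DecidableEquality A → (xs : List A) → Unique xs → Ordering xs
  ordering _≟_ xs u with search (λ _ → ⊤) (λ _ → yes tt) (length xs) xs ≤-refl
  ... | F , (_ ∷ _) , _ , _ , (no₁ ∷ _) , _ = contradiction tt no₁
  ... | F , [] , sF , perm , _ , _
    with ↭-sym (↭-trans perm (++-identityʳ (flat F)))
  ... | perm′ with heights _≟_ (flat F) (unique-resp-↭ (↭-sym perm′) u)
  ... | h , mono , paths = record
    { ord = flat F ; perm = perm′ ; h = h
    ; pairs = proj₁ (search-order h sF mono) ; triples = proj₂ (search-order h sF mono) ; paths = paths }

-- Positions in lists, counting and pigeonhole arguments

module _ {A : Set} where

  index : DecidableEquality A → List A → A → ℕ
  index _≟_ [] v = 0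
  index _≟_ (x ∷ xs) v with x ≟ v
  ... | yes _ = 0
  ... | no _ = suc (index _≟_ xs v)

  module Index (_≟_ : DecidableEquality A) where

    private
      idx : List A → A → ℕ
      idx = index _≟_

    index-pairs : {R : A → A → Set} {xs : List A} → AllPairs R xs →
                  ∀ {u v} → u ∈ xs → v ∈ xs → idx xs u < idx xs v → R u v
    index-pairs {xs = x ∷ xs} (a ∷ r) {u} {v} u∈ v∈ lt with x ≟ u | x ≟ v
    ... | _ | yes refl = contradiction lt λ ()
    ... | yes refl | no ne = All.lookup a (Any.tail (ne ∘ sym) v∈)
    ... | no ne | no ne′ = index-pairs r (Any.tail (ne ∘ sym) u∈) (Any.tail (ne′ ∘ sym) v∈) (s≤s⁻¹ lt)

    index-triples : {P : A → A → A → Set} {xs : List A} → AllTriples P xs →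
                    ∀ {u z v} → u ∈ xs → z ∈ xs → v ∈ xs → idx xs u < idx xs z → idx xs z < idx xs v → P u z v
    index-triples {xs = x ∷ xs} (a , r) {u} {z} {v} u∈ z∈ v∈ lt lt′ with x ≟ u | x ≟ z | x ≟ v
    ... | _ | _ | yes refl = contradiction lt′ λ ()
    ... | _ | yes refl | no _ = contradiction lt λ ()
    ... | yes refl | no ne | no ne′ = index-pairs a (Any.tail (ne ∘ sym) z∈) (Any.tail (ne′ ∘ sym) v∈) (s≤s⁻¹ lt′)
    ... | no ne | no ne′ | no ne″ =
      index-triples r (Any.tail (ne ∘ sym) u∈) (Any.tail (ne′ ∘ sym) z∈) (Any.tail (ne″ ∘ sym) v∈) (s≤s⁻¹ lt) (s≤s⁻¹ lt′)

    index-injective : {xs : List A} → ∀ {u v} → u ∈ xs → v ∈ xs → idx xs u ≡ idx xs v → u ≡ v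
    index-injective {x ∷ xs} {u} {v} u∈ v∈ eq with x ≟ u | x ≟ v
    ... | yes refl | yes refl = refl
    ... | no ne | no ne′ = index-injective (Any.tail (ne ∘ sym) u∈) (Any.tail (ne′ ∘ sym) v∈) (suc-injective eq)

    index-drop : ∀ d {xs : List A} → Unique xs → ∀ {v} → v ∈ drop d xs → d ≤ idx xs v
    index-drop zero u v∈ = z≤n
    index-drop (suc d) {x ∷ xs} (x∉ ∷ u) {v} v∈ with x ≟ v
    ... | yes refl = contradiction refl (All.lookup x∉ (drop-⊆ d v∈))
      where
      drop-⊆ : ∀ d {ys : List A} {v} → v ∈ drop d ys → v ∈ ys
      drop-⊆ zero v∈ = v∈
      drop-⊆ (suc d) {y ∷ ys} v∈ = there (drop-⊆ d v∈)
    ... | no _ = s≤s (index-drop d u v∈)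

    index-take : ∀ d m {xs : List A} {v} → v ∈ take m (drop d xs) → idx xs v < d + m
    index-take zero (suc m) {x ∷ xs} {v} v∈ with x ≟ v
    ... | yes _ = s≤s z≤n
    ... | no ne = s≤s (index-take zero m (Any.tail (ne ∘ sym) v∈))
    index-take (suc d) zero {x ∷ xs} ()
    index-take (suc d) (suc m) {x ∷ xs} {v} v∈ with x ≟ v
    ... | yes _ = s≤s z≤n
    ... | no _ = s≤s (index-take d (suc m) v∈)

  # : {P : A → Set} → Decidable P → List A → ℕ
  # P? xs = length (filter P? xs)

  #-++ : {P : A → Set} (P? : Decidable P) (xs : List A) {ys : List A} → # P? (xs ++ ys) ≡ # P? xs + # P? ys
  #-++ P? xs {ys} = trans (cong length (filter-++ P? xs ys)) (length-++ (filter P? xs))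

  filter-⊆ : {P : A → Set} (P? : Decidable P) {xs : List A} → filter P? xs ⊆ xs
  filter-⊆ P? v∈ = proj₁ (∈-filter⁻ P? v∈)

  filter-All : {P : A → Set} (P? : Decidable P) {xs : List A} → All P (filter P? xs)
  filter-All P? {xs} = Allₚ.all-filter P? xs

  cover : {P Q : A → Set} (P? : Decidable P) (Q? : Decidable Q) {xs : List A} →
          (∀ {x} → x ∈ xs → P x ⊎ Q x) → length xs ≤ # P? xs + # Q? xs
  cover P? Q? {[]} f = z≤n
  cover P? Q? {x ∷ xs} f with cover P? Q? {xs} (f ∘ there) | P? x | Q? x
  ... | ih | yes _ | yes _ = s≤s (≤-trans ih (+-monoʳ-≤ (# P? xs) (n≤1+n _)))
  ... | ih | yes _ | no _ = s≤s ih
  ... | ih | no _ | yes _ = subst (suc (length xs) ≤_) (sym (+-suc _ _)) (s≤s ih)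
  ... | ih | no ¬p | no ¬q = contradiction (f (here refl)) [ ¬p , ¬q ]′

  complement : {P : A → Set} (P? : Decidable P) (xs : List A) → length xs ≤ # P? xs + # (λ x → ¬? (P? x)) xs
  complement P? xs = cover P? (λ x → ¬? (P? x)) {xs} (λ {x} _ → toSum (P? x))

  #-filter : {P Q : A → Set} (P? : Decidable P) (Q? : Decidable Q) (xs : List A) → # P? (filter Q? xs) ≤ # P? xs
  #-filter P? Q? [] = z≤n
  #-filter P? Q? (x ∷ xs) with Q? x
  ... | yes _ with P? x
  ... | yes _ = s≤s (#-filter P? Q? xs)
  ... | no _ = #-filter P? Q? xs
  #-filter P? Q? (x ∷ xs) | no _ with P? x
  ... | yes _ = m≤n⇒m≤1+n (#-filter P? Q? xs)
  ... | no _ = #-filter P? Q? xs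

  -- Pigeonhole by induction on the number of possible values: a level with fewer than `r` elements
  -- is removed, and enough remains for the other levels.
  largeLevel : (f : A → ℕ) (w c r : ℕ) {xs : List A} → All (λ x → c ≤ f x × f x < c + w) xs → w * r < length xs →
               ∃[ c′ ] r ≤ # (λ x → f x ℕ.≟ c′) xs
  largeLevel f zero c r {x ∷ xs} ((c≤ , <c) ∷ _) lt =
    contradiction (≤-<-trans c≤ (subst (f x <_) (+-identityʳ c) <c)) (n≮n c)
  largeLevel f (suc w) c r {xs} a lt with r ≤? # (λ x → f x ℕ.≟ c) xs
  ... | yes p = c , p
  ... | no np with largeLevel f w (suc c) r {filter (λ x → ¬? (f x ℕ.≟ c)) xs} a′ lt′
    where
    a′ : All (λ x → suc c ≤ f x × f x < suc c + w) (filter (λ x → ¬? (f x ℕ.≟ c)) xs)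
    a′ = All.tabulate λ x∈ → let x∈xs , ne = ∈-filter⁻ (λ x → ¬? (f x ℕ.≟ c)) x∈ in
      let l , u = All.lookup a x∈xs in ≤∧≢⇒< l (ne ∘ sym) , <-≤-trans u (≤-reflexive (+-suc c w))
    lt′ : w * r < # (λ x → ¬? (f x ℕ.≟ c)) xs
    lt′ = +-cancelˡ-< r _ _ (<-≤-trans lt (≤-trans (complement (λ x → f x ℕ.≟ c) xs)
      (+-monoˡ-≤ (# (λ x → ¬? (f x ℕ.≟ c)) xs) (<⇒≤ (≰⇒> np)))))
  ... | c′ , p = c′ , ≤-trans p (#-filter (λ x → f x ℕ.≟ c′) (λ x → ¬? (f x ℕ.≟ c)) xs)

  -- Rédei's theorem: `x` is inserted into a Hamiltonian path of the rest just before the first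
  -- vertex to which it has an edge, or at the end.
  tournamentPath : {R : A → A → Set} {xs : List A} → AllPairs (λ x y → R x y ⊎ R y x) xs →
                   ∃[ ys ] (ys ↭ xs × Linked R ys)
  tournamentPath [] = [] , ↭-refl , []
  tournamentPath {R} {x ∷ xs} (a ∷ r) with tournamentPath r
  ... | [] , perm , _ = x ∷ [] , prep x perm , [-]
  ... | y ∷ ys , perm , link with All-resp-↭ (↭-sym perm) a
  ... | inj₁ xy ∷ _ = x ∷ y ∷ ys , prep x perm , xy ∷ link
  ... | inj₂ yx ∷ a′ with insert link yx a′
    where
    insert : ∀ {y ys} → Linked R (y ∷ ys) → R y x → All (λ z → R x z ⊎ R z x) ys → ∃[ zs ] (zs ↭ x ∷ ys × Linked R (y ∷ zs))
    insert {ys = []} _ yx _ = x ∷ [] , ↭-refl , yx ∷ [-]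
    insert {ys = z ∷ _} (yz ∷ link) yx (inj₁ xz ∷ _) = x ∷ z ∷ _ , ↭-refl , yx ∷ xz ∷ link
    insert {ys = z ∷ zs} (yz ∷ link) yx (inj₂ zx ∷ a) with insert link zx a
    ... | zs′ , perm , link′ = z ∷ zs′ ,
      ↭-trans (prep z perm) (↭-swap z x ↭-refl) , yz ∷ link′
  ... | zs , perm′ , link′ = y ∷ zs ,
    ↭-trans (prep y perm′) (↭-trans (↭-swap y x ↭-refl) (prep x perm)) , link′

  PathFrom : (A → A → Set) → (A → Set) → ℕ → A → Set
  PathFrom R P r x = ∃[ q ] (suc (length q) ≡ r × Linked R (x ∷ q) × Unique (x ∷ q) × All P (x ∷ q))

  PathFrom-map : ∀ {R R′ : A → A → Set} {P Q : A → Set} {r x} → (∀ {u v} → R u v → R′ u v) → (∀ {v} → P v → Q v) →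
                 PathFrom R P r x → PathFrom R′ Q r x
  PathFrom-map f g (q , len , link , u , a) = q , len , Linked.map f link , u , All.map g a

  truncate : ∀ {R P x} q r → r ≤ length q → Linked R (x ∷ q) → Unique (x ∷ q) → All P (x ∷ q) → PathFrom R P (suc r) x
  truncate {R} q r le link u a = take r q , cong suc (trans (length-take r q) (m≤n⇒m⊓n≡m le)) , linked-take r link ,
    Uniqueₚ.take⁺ (suc r) u , Allₚ.take⁺ (suc r) a
    where
    linked-take : ∀ {x q} r → Linked R (x ∷ q) → Linked R (x ∷ take r q)
    linked-take zero _ = [-]
    linked-take (suc r) [-] = [-]
    linked-take (suc r) (e ∷ link) = e ∷ linked-take r link

  -- While at least `z` elements are left, one more good element can be found and removed.
  manyStarts : DecidableEquality A → {P : A → Set} (z : ℕ) (S : List A) → Unique S →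
    (∀ Z → Unique Z → Z ⊆ S → z ≤ length Z → ∃[ x ] (x ∈ Z × P x)) →
    ∀ j → z + j ≤ length S → ∃[ xs ] (Unique xs × length xs ≡ j × xs ⊆ S × All P xs)
  manyStarts _≟_ z S u f zero le = [] , [] , refl , (λ ()) , []
  manyStarts _≟_ {P} z S u f (suc j) le with f S u id (≤-trans (m≤m+n z (suc j)) le)
  ... | x , x∈ , px with manyStarts _≟_ z (filter (λ y → ¬? (x ≟ y)) S) (Uniqueₚ.filter⁺ _ u)
                          (λ Z uZ sub → f Z uZ (filter-⊆ _ ∘ sub)) j
                          (s≤s⁻¹ (subst (_≤ suc (# (λ y → ¬? (x ≟ y)) S)) (+-suc z j) (≤-trans le (unique-⊆-length u S⊆))))
    where
    S⊆ : S ⊆ x ∷ filter (λ y → ¬? (x ≟ y)) S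
    S⊆ {v} v∈ with x ≟ v
    ... | yes refl = here refl
    ... | no ne = there (∈-filter⁺ (λ y → ¬? (x ≟ y)) v∈ ne)
  ... | xs , ux , len , sub , a = x ∷ xs ,
    All.tabulate (λ y∈ → proj₂ (∈-filter⁻ (λ y → ¬? (x ≟ y)) {xs = S} (sub y∈))) ∷ ux , cong suc len ,
    (λ { (here refl) → x∈ ; (there y∈) → filter-⊆ _ (sub y∈) }) , px ∷ a

  #-accept : {P : A → Set} (P? : Decidable P) {x : A} {xs : List A} → P x → # P? (x ∷ xs) ≡ suc (# P? xs)
  #-accept P? p = cong length (filter-accept P? p)

  #-reject : {P : A → Set} (P? : Decidable P) {x : A} {xs : List A} → ¬ P x → # P? (x ∷ xs) ≡ # P? xs
  #-reject P? p = cong length (filter-reject P? p)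

  -- The prefix ends as soon as one of the two counts reaches its target.
  cut : {P Q : A → Set} (P? : Decidable P) (Q? : Decidable Q) (i j : ℕ) (xs : List A) → i ≤ # P? xs →
        ∃[ as ] ∃[ bs ] (xs ≡ as ++ bs × ((# P? as ≡ i × # Q? as ≤ j) ⊎ (# Q? as ≡ j × # P? as ≤ i)))
  cut P? Q? zero j xs le = [] , xs , refl , inj₁ (refl , z≤n)
  cut P? Q? (suc i) zero xs le = [] , xs , refl , inj₂ (refl , z≤n)
  cut P? Q? (suc i) (suc j) (x ∷ xs) le with P? x | Q? x
  ... | yes p | yes q with cut P? Q? i j xs (s≤s⁻¹ le)
  ... | as , bs , refl , r = x ∷ as , bs , refl , Sum.map
    (λ (a , b) → trans (#-accept P? p) (cong suc a) , subst (_≤ suc j) (sym (#-accept Q? q)) (s≤s b))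
    (λ (a , b) → trans (#-accept Q? q) (cong suc a) , subst (_≤ suc i) (sym (#-accept P? p)) (s≤s b)) r
  cut P? Q? (suc i) (suc j) (x ∷ xs) le | yes p | no q with cut P? Q? i (suc j) xs (s≤s⁻¹ le)
  ... | as , bs , refl , r = x ∷ as , bs , refl , Sum.map
    (λ (a , b) → trans (#-accept P? p) (cong suc a) , subst (_≤ suc j) (sym (#-reject Q? q)) b)
    (λ (a , b) → trans (#-reject Q? q) a , subst (_≤ suc i) (sym (#-accept P? p)) (s≤s b)) r
  cut P? Q? (suc i) (suc j) (x ∷ xs) le | no p | yes q with cut P? Q? (suc i) j xs le
  ... | as , bs , refl , r = x ∷ as , bs , refl , Sum.map
    (λ (a , b) → trans (#-reject P? p) a , subst (_≤ suc j) (sym (#-accept Q? q)) (s≤s b))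
    (λ (a , b) → trans (#-accept Q? q) (cong suc a) , subst (_≤ suc i) (sym (#-reject P? p)) b) r
  cut P? Q? (suc i) (suc j) (x ∷ xs) le | no p | no q with cut P? Q? (suc i) (suc j) xs le
  ... | as , bs , refl , r = x ∷ as , bs , refl , Sum.map
    (λ (a , b) → trans (#-reject P? p) a , subst (_≤ suc j) (sym (#-reject Q? q)) b)
    (λ (a , b) → trans (#-reject Q? q) a , subst (_≤ suc i) (sym (#-reject P? p)) b) r

-- A rooted tree cut into vertical paths: the path a ∷ as, whose last vertex has the roots of ks as children.
data Chunk (A : Set) : Set where
  chunk : A → List A → List (Chunk A) → Chunk A

-- Chunked trees and their embeddings

module _ {A : Set} where

  root : Chunk A → A
  root (chunk a _ _) = a

  final : A → List A → A
  final a [] = a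
  final a (b ∷ bs) = final b bs

  labels : Chunk A → List A
  labelss : List (Chunk A) → List A
  labels (chunk a as ks) = (a ∷ as) ++ labelss ks
  labelss [] = []
  labelss (κ ∷ ks) = labels κ ++ labelss ks

  -- The number of units that `place` consumes. The top chunk gets one more than it has children, so
  -- that `goodUnit` has more candidates than targets.
  cost : Chunk A → ℕ
  costs : List (Chunk A) → ℕ
  cost (chunk a as ks) = suc (length ks) + costs ks
  costs [] = 0
  costs (κ ∷ ks) = cost κ + costs ks

  Short : ℕ → Chunk A → Set
  Shorts : ℕ → List (Chunk A) → Set
  Short ℓ (chunk a as ks) = suc (length as) ≤ ℓ × Shorts ℓ ks
  Shorts ℓ [] = ⊤
  Shorts ℓ (κ ∷ ks) = Short ℓ κ × Shorts ℓ ks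

  data Consecutive : A → List A → A → A → Set where
    first : ∀ {a b bs} → Consecutive a (b ∷ bs) a b
    later : ∀ {a b bs u v} → Consecutive b bs u v → Consecutive a (b ∷ bs) u v

  data Arc : Chunk A → A → A → Set where
    along : ∀ {a as ks u v} → Consecutive a as u v → Arc (chunk a as ks) u v
    down  : ∀ {a as ks κ} → κ ∈ ks → Arc (chunk a as ks) (final a as) (root κ)
    child : ∀ {a as ks κ u v} → κ ∈ ks → Arc κ u v → Arc (chunk a as ks) u v

  splitSum : {P Q : A → Set} {xs : List A} → Unique xs → (∀ {x} → x ∈ xs → P x ⊎ Q x) →
    ∃[ ys ] ∃[ zs ] (Unique ys × Unique zs × ys ⊆ xs × zs ⊆ xs × All P ys × All Q zs × length ys + length zs ≡ length xs)
  splitSum {xs = []} [] f = [] , [] , [] , [] , id , id , [] , [] , refl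
  splitSum {xs = x ∷ xs} (x∉ ∷ u) f with splitSum u (f ∘ there) | f (here refl)
  ... | ys , zs , uy , uz , sy , sz , py , qz , len | inj₁ p =
    x ∷ ys , zs , All.tabulate (λ y∈ → All.lookup x∉ (sy y∈)) ∷ uy , uz ,
    (λ { (here refl) → here refl ; (there y∈) → there (sy y∈) }) , there ∘ sz , p ∷ py , qz , cong suc len
  ... | ys , zs , uy , uz , sy , sz , py , qz , len | inj₂ q =
    ys , x ∷ zs , uy , All.tabulate (λ y∈ → All.lookup x∉ (sz y∈)) ∷ uz ,
    there ∘ sy , (λ { (here refl) → here refl ; (there y∈) → there (sz y∈) }) , py , q ∷ qz , trans (+-suc _ _) (cong suc len)

  #-sub : {P Q R : A → Set} (P? : Decidable P) (Q? : Decidable Q) (R? : Decidable R) (xs : List A) →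
          (∀ {x} → P x → Q x ⊎ R x) → # P? xs ≤ # Q? xs + # R? xs
  #-sub P? Q? R? xs f = ≤-trans (cover Q? R? {filter P? xs} (λ x∈ → f (proj₂ (∈-filter⁻ P? {xs = xs} x∈))))
    (+-mono-≤ (#-filter Q? P? xs) (#-filter R? P? xs))

-- An association list, so that embeddings of disjoint subtrees are combined by concatenation;
-- `realise` turns it into a function when the labels are distinct.
record Embedding {A V : Set} (R : V → V → Set) (κ : Chunk A) (x : V) (Ok : V → Set) : Set where
  field
    ψ : List (A × V)
    keys : map proj₁ ψ ≡ labels κ
    injective : Unique (map proj₂ ψ)
    inside : All Ok (map proj₂ ψ)
    rooted : (root κ , x) ∈ ψ
    arcs : ∀ {u v} → Arc κ u v → ∃[ a ] ∃[ b ] ((u , a) ∈ ψ × (v , b) ∈ ψ × R a b)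

nonempty : {A : Set} (xs : List A) → 1 ≤ length xs → ∃[ x ] x ∈ xs
nonempty (x ∷ _) _ = x , here refl

-- Choosing single blocks or pairs of blocks

Earlier : ℕ × List ℕ → ℕ × List ℕ → Set
Earlier (a , bs) (a′ , bs′) = a < a′ × Disjointₗ bs bs′

doubled : ℕ × ℕ → ℕ × List ℕ
doubled (a , b) = a , a ∷ b ∷ []

Matches : (ℕ → ℕ) → List ℕ → List ℕ → ℕ × ℕ → Set
Matches c pool as (a , b) = a ∈ as × b ∈ pool ++ as × b < a × c a ≡ c b

-- Greedy matching of equal classes: pool holds the unmatched numbers met so far.
match : (c : ℕ → ℕ) (Γ : ℕ) (pool as : List ℕ) → Unique (pool ++ as) → AllPairs _<_ as → All (λ a → All (_< a) pool) as →
  Unique (map c pool) → All (λ a → c a < Γ) (pool ++ as) →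
  ∃[ ps ] (All (Matches c pool as) ps ×
    AllPairs (Earlier on doubled) ps ×
    length as + length pool ≤ (length ps + length ps) + Γ)
-- What stays unmatched has pairwise different classes, all below `Γ`.
match c Γ pool [] u inc lt distinct bound = [] , [] , [] , subst (_≤ Γ) (length-map c pool)
  (unique-bounded-length distinct (Allₚ.map⁺ (Allₚ.++⁻ˡ pool bound)))
match c Γ pool (a ∷ as) u (a< ∷ inc) (lta ∷ lt) distinct bound with Any.any? (λ b → c b ℕ.≟ c a) pool
... | no none with match c Γ (a ∷ pool) as
      (unique-resp-↭ (shift a pool as) u) inc (All.zipWith (λ (p , q) → p ∷ q) (a< , lt))
      (Allₚ.map⁺ (All.map (λ ne eq → ne (sym eq)) (Allₚ.¬Any⇒All¬ pool none)) ∷ distinct) (All-resp-↭ (shift a pool as) bound)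
... | ps , prop , sorted , count = ps ,
  All.map (λ (a∈ , b∈ , rest) → there a∈ , ∈-resp-↭ (↭-sym (shift a pool as)) b∈ , rest) prop , sorted ,
  subst (_≤ (length ps + length ps) + Γ) (+-suc (length as) (length pool)) count
match c Γ pool (a ∷ as) u (a< ∷ inc) (lta ∷ lt) distinct bound | yes some with extract some
... | b , pool′ , eq , perm
  with unique-resp-↭ (↭-trans (shift a pool as) (prep a (++⁺ʳ as perm))) u
     | All-resp-↭ (↭-trans (shift a pool as) (prep a (++⁺ʳ as perm))) bound
     | unique-resp-↭ (map⁺ c perm) distinct
... | (a∉ ∷ b∉ ∷ u′) | (_ ∷ _ ∷ bound′) | (_ ∷ distinct′)
  with match c Γ pool′ as u′ inc (All.map (λ p → All.tail (All-resp-↭ perm p)) lt) distinct′ bound′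
... | ps , prop , sorted , count = (a , b) ∷ ps ,
  (here refl , ∈-++⁺ˡ b∈ , All.lookup lta b∈ , sym eq) ∷
    All.map (λ (a∈ , b∈ , rest) → there a∈ , back b∈ , rest) prop ,
  All.map (λ (a∈ , b∈ , _) → All.lookup a< a∈ , λ {v} → fresh a∈ b∈ {v}) prop ∷ sorted ,
  counted
  where
  b∈ : b ∈ pool
  b∈ = ∈-resp-↭ (↭-sym perm) (here refl)
  back : ∀ {x} → x ∈ pool′ ++ as → x ∈ pool ++ a ∷ as
  back x∈ = ∈-resp-↭ (↭-sym (↭-trans (shift a pool as) (prep a (++⁺ʳ as perm)))) (there (there x∈))
  fresh : ∀ {a′ b′} → a′ ∈ as → b′ ∈ pool′ ++ as → Disjointₗ (a ∷ b ∷ []) (a′ ∷ b′ ∷ [])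
  fresh a∈ b∈ (here refl , here refl) = All.lookup a∉ (there (∈-++⁺ʳ pool′ a∈)) refl
  fresh a∈ b∈ (here refl , there (here refl)) = All.lookup a∉ (there b∈) refl
  fresh a∈ b∈ (there (here refl) , here refl) = All.lookup b∉ (∈-++⁺ʳ pool′ a∈) refl
  fresh a∈ b∈ (there (here refl) , there (here refl)) = All.lookup b∉ b∈ refl
  counted : suc (length as) + length pool ≤ (suc (length ps) + suc (length ps)) + Γ
  counted = begin
    suc (length as) + length pool             ≡⟨ cong (suc (length as) +_) (↭-length perm) ⟩
    suc (length as) + suc (length pool′)      ≡⟨ cong suc (+-suc _ _) ⟩
    suc (suc (length as + length pool′))      ≤⟨ s≤s (s≤s count) ⟩
    suc (suc (length ps + length ps + Γ))     ≡⟨ cong (λ m → suc m + Γ) (sym (+-suc (length ps) (length ps))) ⟩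
    (suc (length ps) + suc (length ps)) + Γ   ∎
    where open ≤-Reasoning

data Kind (Low : ℕ → Set) (class : ℕ → ℕ) (t : ℕ) : ℕ × List ℕ → Set where
  alone  : ∀ {a} → a < t → ¬ Low a → Kind Low class t (a , a ∷ [])
  paired : ∀ {a b} → a < t → b < a → class a ≡ class b → Low b → Kind Low class t (a , a ∷ b ∷ [])

-- Either `q` numbers are not `Low`, and each serves alone, or more than t - q are `Low`. All but at
-- most `Γ` of these are matched, and t ≥ 3q + Γ leaves at least `q` pairs.
select : {Low : ℕ → Set} (Low? : Decidable Low) (class : ℕ → ℕ) (q Γ t : ℕ) →
  (∀ {a} → a < t → class a < Γ) → (q + q) + q + Γ ≤ t →
  ∃[ items ] (AllPairs Earlier items ×
    All (Kind Low class t) items × q ≤ length items)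
select {Low} Low? class q Γ t bound enough = decide (q ≤? length others)
  where
  others lows : List ℕ
  others = filter (λ a → ¬? (Low? a)) (upTo t)
  lows = filter Low? (upTo t)
  increasing : AllPairs _<_ (upTo t)
  increasing = AllPairsₚ.applyUpTo⁺₁ id t (λ lt _ → lt)
  decide : Dec (q ≤ length others) → _
  decide (yes le) = map (λ a → a , a ∷ []) others ,
    AllPairsₚ.map⁺ (AllPairs.map (λ lt → lt , λ { (here refl , here refl) → n≮n _ lt }) (AllPairsₚ.filter⁺ _ increasing)) ,
    Allₚ.map⁺ (All.tabulate λ a∈ → let a∈t , not-low = ∈-filter⁻ (λ a → ¬? (Low? a)) {xs = upTo t} a∈ in
      alone (∈-upTo⁻ a∈t) not-low) ,
    subst (q ≤_) (sym (length-map _ others)) le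
  decide (no few) with match class Γ [] lows (Uniqueₚ.filter⁺ Low? (Uniqueₚ.upTo⁺ t)) (AllPairsₚ.filter⁺ Low? increasing)
    (All.tabulate λ _ → []) [] (All.tabulate λ a∈ → bound (∈-upTo⁻ (filter-⊆ Low? a∈)))
  ... | ps , prop , sorted , count = map doubled ps , AllPairsₚ.map⁺ sorted ,
    Allₚ.map⁺ (All.map (λ (a∈ , b∈ , b<a , same) →
      paired (∈-upTo⁻ (filter-⊆ Low? a∈)) b<a same (proj₂ (∈-filter⁻ Low? {xs = upTo t} b∈))) prop) ,
    subst (q ≤_) (sym (length-map _ ps)) (≮⇒≥ λ lt → <-irrefl refl (begin-strict
      length ps + length ps + Γ + q    <⟨ +-monoˡ-< q (+-monoˡ-< Γ (+-mono-< lt lt)) ⟩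
      q + q + Γ + q                    ≡⟨ rearrange q Γ ⟩
      (q + q) + q + Γ                  ≤⟨ enough ⟩
      t                                ≡⟨ length-upTo t ⟨
      length (upTo t)                  ≤⟨ complement Low? (upTo t) ⟩
      length lows + length others      ≤⟨ +-mono-≤ (subst (_≤ length ps + length ps + Γ) (+-identityʳ (length lows)) count) (<⇒≤ (≰⇒> few)) ⟩
      length ps + length ps + Γ + q    ∎))
    where
    open ≤-Reasoning
    rearrange : ∀ q Γ → q + q + Γ + q ≡ (q + q) + q + Γ
    rearrange = solve-∀

reverse-linked : {A : Set} {R : A → A → Set} {xs : List A} → Linked (flip R) xs → Linked R (reverse xs)
reverse-linked [] = []
reverse-linked {R = R} {x ∷ xs} link = go xs [] link [-]
  where
  go : ∀ {x} xs ys → Linked (flip R) (x ∷ xs) → Linked R (x ∷ ys) → Linked R (xs ʳ++ (x ∷ ys))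
  go [] ys _ acc = acc
  go (y ∷ xs) ys (yx ∷ link) acc = go xs (_ ∷ ys) link (yx ∷ acc)

Path : {A : Set} → (A → A → Set) → ℕ → Set
Path R n = ∃[ p ] (length p ≡ n × Linked R p × Unique p)

reversePath : {A : Set} {R : A → A → Set} {n : ℕ} → Path (flip R) n → Path R n
reversePath (p , len , link , u) = reverse p , trans (length-reverse p) len , reverse-linked link ,
  unique-resp-↭ (↭-sym (↭-reverse p)) u

-- N vertices, t blocks of 22 k consecutive vertices; w is the width of a class of heights and ℓ the
-- number of vertices of a chunk.
module Parameters (N k n m λ′ : ℕ) (1≤k : 1 ≤ k) (1≤λ : 1 ≤ λ′)
  (small-n : n * 2048 ≤ N) (small-m : m * 2048 ≤ N)
  (small-nm : m * n * k * 1048576 ≤ N * N) (small-λ : k * λ′ * 4096 ≤ N) where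

  private instance
    k≢0 : NonZero k
    k≢0 = >-nonZero 1≤k
    22k≢0 : NonZero (22 * k)
    22k≢0 = m*n≢0 22 k

  t : ℕ
  t = N / (22 * k)

  fits : t * (22 * k) ≤ N
  fits = m/n*n≤m N (22 * k)

  1≤t : 1 ≤ t
  1≤t = m≥n⇒m/n>0 (≤-trans (≤-trans (*-monoˡ-≤ k (m≤m+n 22 4074)) (≤-trans (≤-reflexive (cong (4096 *_) (sym (*-identityʳ k))))
    (*-monoʳ-≤ 4096 (*-monoʳ-≤ k 1≤λ)))) (≤-trans (≤-reflexive (*-comm 4096 (k * λ′))) small-λ))

  N≤64kt : N ≤ 64 * (k * t)
  N≤64kt = begin
    N                                 ≡⟨ m≡m%n+[m/n]*n N (22 * k) ⟩
    N % (22 * k) + t * (22 * k)       ≤⟨ +-monoˡ-≤ _ (<⇒≤ (m%n<n N (22 * k))) ⟩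
    22 * k + t * (22 * k)             ≤⟨ +-monoˡ-≤ _ (≤-trans (≤-reflexive (sym (*-identityˡ (22 * k)))) (*-monoˡ-≤ (22 * k) 1≤t)) ⟩
    t * (22 * k) + t * (22 * k)       ≡⟨ eq 22 t k ⟩
    44 * (k * t)                      ≤⟨ *-monoˡ-≤ (k * t) (m≤m+n 44 20) ⟩
    64 * (k * t)                      ∎
    where
    open ≤-Reasoning
    eq : ∀ c t k → t * (c * k) + t * (c * k) ≡ (c + c) * (k * t)
    eq = solve-∀

  private instance
    t≢0 : NonZero t
    t≢0 = >-nonZero 1≤t

  -- Chosen so that 8n < wt ≤ 8n + t. By the lower bound, the classes in use have numbers below t/8;
  -- the upper bound gives w ≤ 2k.
  w : ℕ
  w = suc (8 * n / t)

  wt≤ : w * t ≤ 8 * n + t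
  wt≤ = ≤-trans (+-monoʳ-≤ t (m/n*n≤m (8 * n) t)) (≤-reflexive (+-comm t (8 * n)))

  8n<wt : 8 * n < w * t
  8n<wt = begin-strict
    8 * n                             ≡⟨ m≡m%n+[m/n]*n (8 * n) t ⟩
    8 * n % t + (8 * n / t) * t       <⟨ +-monoˡ-< _ (m%n<n (8 * n) t) ⟩
    t + (8 * n / t) * t               ∎
    where open ≤-Reasoning

  8n≤kt : 8 * n ≤ k * t
  8n≤kt = *-cancelˡ-≤ 64 (≤-trans (≤-reflexive (sym (*-assoc 64 8 n))) (≤-trans (*-monoˡ-≤ n (m≤m+n 512 1536)) (≤-trans (≤-trans (≤-reflexive (*-comm 2048 n)) small-n) N≤64kt)))

  w≤2k : w ≤ k + k
  w≤2k = *-cancelʳ-≤ w (k + k) t (≤-trans wt≤ (≤-trans (+-mono-≤ 8n≤kt (m≤n*m t k)) (≤-reflexive (sym (*-distribʳ-+ t k k)))))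

  -- The largest length for which `w` levels of `ℓ` vertices amount to at most 2k vertices.
  ℓ : ℕ
  ℓ = (k + k) / w

  wℓ≤2k : w * ℓ ≤ k + k
  wℓ≤2k = ≤-trans (≤-reflexive (*-comm w ℓ)) (m/n*n≤m (k + k) w)

  ℓ≤2k : ℓ ≤ k + k
  ℓ≤2k = ≤-trans (m≤n*m ℓ w) wℓ≤2k

  1≤ℓ : 1 ≤ ℓ
  1≤ℓ = m≥n⇒m/n>0 w≤2k

  k≤ℓw : k ≤ ℓ * w
  k≤ℓw = *-cancelˡ-≤ 2 (begin
    2 * k                       ≡⟨ cong (k +_) (+-identityʳ k) ⟩
    k + k                       ≡⟨ m≡m%n+[m/n]*n (k + k) w ⟩
    (k + k) % w + ℓ * w         ≤⟨ +-monoˡ-≤ (ℓ * w) (<⇒≤ (m%n<n (k + k) w)) ⟩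
    w + ℓ * w                   ≤⟨ +-monoˡ-≤ (ℓ * w) (m≤n*m w ℓ {{>-nonZero 1≤ℓ}}) ⟩
    ℓ * w + ℓ * w               ≡⟨ cong (ℓ * w +_) (sym (+-identityʳ (ℓ * w))) ⟩
    2 * (ℓ * w)                 ∎)
    where open ≤-Reasoning

  64λ≤t : 64 * λ′ ≤ t
  64λ≤t = *-cancelˡ-≤ (64 * k) {{m*n≢0 64 k}} (begin
    64 * k * (64 * λ′)          ≡⟨ eq 64 k λ′ ⟩
    4096 * (k * λ′)             ≡⟨ *-comm 4096 (k * λ′) ⟩
    k * λ′ * 4096               ≤⟨ ≤-trans small-λ N≤64kt ⟩
    64 * (k * t)                ≡⟨ *-assoc 64 k t ⟨
    64 * k * t                  ∎)
    where
    open ≤-Reasoning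
    eq : ∀ c k l → c * k * (c * l) ≡ c * c * (k * l)
    eq = solve-∀

  256mn≤ktt : 256 * (m * n) ≤ k * t * t
  256mn≤ktt = *-cancelˡ-≤ (4096 * k) {{m*n≢0 4096 k}} (begin
    4096 * k * (256 * (m * n))            ≡⟨ eq 4096 256 k (m * n) ⟩
    1048576 * (m * n * k)                 ≡⟨ *-comm 1048576 (m * n * k) ⟩
    m * n * k * 1048576                   ≤⟨ small-nm ⟩
    N * N                                 ≤⟨ *-mono-≤ N≤64kt N≤64kt ⟩
    64 * (k * t) * (64 * (k * t))         ≡⟨ eq′ 64 k t ⟩
    4096 * k * (k * t * t)                ∎)
    where
    open ≤-Reasoning
    eq : ∀ c d k a → c * k * (d * a) ≡ c * d * (a * k)
    eq = solve-∀
    eq′ : ∀ c k t → c * (k * t) * (c * (k * t)) ≡ c * c * k * (k * t * t)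
    eq′ = solve-∀

  32m≤kt : 32 * m ≤ k * t
  32m≤kt = *-cancelˡ-≤ 64 (≤-trans (≤-reflexive (sym (*-assoc 64 32 m))) (≤-trans (≤-trans (≤-reflexive (*-comm 2048 m)) small-m) N≤64kt))

  -- The hypothesis on the product of `n` and `m` enters here. After multiplication by 2wt, the
  -- bound `wt≤` splits the left side into 256mn, controlled by that hypothesis, and 32mt,
  -- controlled by the bound on `m`.
  16m≤ℓt : 16 * m ≤ ℓ * t
  16m≤ℓt = *-cancelʳ-≤ (16 * m) (ℓ * t) (2 * (w * t)) {{m*n≢0 2 (w * t) {{_}} {{m*n≢0 w t}}}} (begin
    16 * m * (2 * (w * t))                ≤⟨ *-monoʳ-≤ (16 * m) (*-monoʳ-≤ 2 wt≤) ⟩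
    16 * m * (2 * (8 * n + t))            ≡⟨ eq 16 8 m n t ⟩
    256 * (m * n) + 32 * m * t            ≤⟨ +-mono-≤ 256mn≤ktt (*-monoˡ-≤ t 32m≤kt) ⟩
    k * t * t + k * t * t                 ≤⟨ +-mono-≤ bound bound ⟩
    ℓ * w * t * t + ℓ * w * t * t         ≡⟨ eq′ ℓ w t ⟩
    ℓ * t * (2 * (w * t))                 ∎)
    where
    open ≤-Reasoning
    bound : k * t * t ≤ ℓ * w * t * t
    bound = *-monoˡ-≤ t (*-monoˡ-≤ t k≤ℓw)
    eq : ∀ c d m n t → c * m * (2 * (d * n + t)) ≡ 2 * (c * d) * (m * n) + 2 * c * m * t
    eq = solve-∀
    eq′ : ∀ l w t → l * w * t * t + l * w * t * t ≡ l * t * (2 * (w * t))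
    eq′ = solve-∀

  -- For `q` the cost of the tree, 8ℓq is at most 16m + 32ℓλ′, and each summand is at most ℓt.
  4q≤t : ∀ {q} → ℓ * q ≤ 2 * (m + 2 * (ℓ * λ′)) → 4 * q ≤ t
  4q≤t {q} le = *-cancelˡ-≤ (2 * ℓ) {{m*n≢0 2 ℓ {{_}} {{>-nonZero 1≤ℓ}}}} (begin
    2 * ℓ * (4 * q)                       ≡⟨ eq ℓ q ⟩
    8 * (ℓ * q)                           ≤⟨ *-monoʳ-≤ 8 le ⟩
    8 * (2 * (m + 2 * (ℓ * λ′)))          ≡⟨ eq′ 8 m ℓ λ′ ⟩
    16 * m + ℓ * (32 * λ′)                ≤⟨ +-mono-≤ 16m≤ℓt (*-monoʳ-≤ ℓ (≤-trans (*-monoˡ-≤ λ′ (m≤m+n 32 32)) 64λ≤t)) ⟩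
    ℓ * t + ℓ * t                         ≡⟨ eq″ ℓ t ⟩
    2 * ℓ * t                             ∎)
    where
    open ≤-Reasoning
    eq : ∀ l q → 2 * l * (4 * q) ≡ 8 * (l * q)
    eq = solve-∀
    eq′ : ∀ c m l a → c * (2 * (m + 2 * (l * a))) ≡ c * 2 * m + l * (c * 4 * a)
    eq′ = solve-∀
    eq″ : ∀ l t → l * t + l * t ≡ 2 * l * t
    eq″ = solve-∀

  -- `select` needs room for 3q blocks besides the classes: the former take at most three quarters
  -- of `t`, the class numbers stay below one eighth.
  few-classes : ∀ {q} → 4 * q ≤ t → ∀ {j} → j * w < n → j + ((q + q) + q) < t
  few-classes {q} 4q≤t {j} jw<n = *-cancelˡ-< 8 _ _ (begin-strict
    8 * (j + ((q + q) + q))               ≡⟨ eq j q ⟩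
    8 * j + 6 * (4 * q)                   <⟨ +-mono-<-≤ 8j<t (*-monoʳ-≤ 6 4q≤t) ⟩
    t + 6 * t                             ≤⟨ *-monoˡ-≤ t (m≤m+n 7 1) ⟩
    8 * t                                 ∎)
    where
    open ≤-Reasoning
    eq : ∀ j q → 8 * (j + ((q + q) + q)) ≡ 8 * j + 6 * (4 * q)
    eq = solve-∀
    8j<t : 8 * j < t
    8j<t = *-cancelˡ-< w (8 * j) t (begin-strict
      w * (8 * j)                         ≡⟨ trans (*-comm w (8 * j)) (*-assoc 8 j w) ⟩
      8 * (j * w)                         ≤⟨ *-monoʳ-≤ 8 (<⇒≤ jw<n) ⟩
      8 * n                               <⟨ 8n<wt ⟩
      w * t                               ∎)

-- Units in a two-coloured tournament

module Host {V : Set} (_≟_ : DecidableEquality V)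
  (Bl Rd : V → V → Set) (Bl? : Decidable₂ Bl) (Rd? : Decidable₂ Rd)
  (total : ∀ {u v} → u ≢ v → (Bl u v ⊎ Bl v u) ⊎ (Rd u v ⊎ Rd v u))
  (k : ℕ) (1≤k : 1 ≤ k)
  (joined : ∀ {xs ys} → Unique xs → Unique ys → Disjointₗ xs ys → k ≤ length xs → k ≤ length ys →
            ∃[ x ] ∃[ y ] (x ∈ xs × y ∈ ys × (Bl x y ⊎ Rd x y)))
  where

  _∈?_ : (v : V) (xs : List V) → Dec (v ∈ xs)
  v ∈? xs = Any.any? (v ≟_) xs

  Free : V → V → Set
  Free u v = ¬ Bl u v

  -- A pair unit has two sides of size pairSize, a level unit has size levelSize.
  pairSize levelSize : ℕ
  pairSize = (k + k) + ((k + k) + (k + k) + k)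
  levelSize = (k + k) + ((k + k) + (k + k))

  -- In a block used alone, fewer than 7k vertices lie below its class or at its lower end, fewer
  -- than 7k lie above it, and at most w ≤ 2k are dropped for receiving early blue edges. Of 22k
  -- vertices, 6k remain for a level unit.
  sizes-fit : ∀ {w} → w ≤ k + k → (pairSize + pairSize) + (w + levelSize) ≤ 22 * k
  sizes-fit w≤2k = ≤-trans (+-monoʳ-≤ (pairSize + pairSize) (+-monoˡ-≤ levelSize w≤2k)) (≤-reflexive (eq k))
    where
    eq : ∀ k → (((k + k) + ((k + k) + (k + k) + k)) + ((k + k) + ((k + k) + (k + k) + k))) +
               ((k + k) + ((k + k) + ((k + k) + (k + k)))) ≡ 22 * k
    eq = solve-∀

  redEdge : ∀ {xs ys} → Unique xs → Unique ys → Disjointₗ xs ys → k ≤ length xs → k ≤ length ys →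
            (∀ {x y} → x ∈ xs → y ∈ ys → Free x y) → ∃[ x ] ∃[ y ] (x ∈ xs × y ∈ ys × Rd x y)
  redEdge ux uy dis lx ly free with joined ux uy dis lx ly
  ... | x , y , x∈ , y∈ , inj₁ b = contradiction b (free x∈ y∈)
  ... | x , y , x∈ , y∈ , inj₂ r = x , y , x∈ , y∈ , r

  -- Distinct vertices of equal `f` are joined by no blue edge, so a large level is a red
  -- tournament, and `tournamentPath` gives a red path through all of it.
  levelPath : (f : V → ℕ) (w c r : ℕ) {Z : List V} → Unique Z → All (λ x → c ≤ f x × f x < c + w) Z →
    (∀ {u v} → u ∈ Z → v ∈ Z → u ≢ v → f u ≡ f v → Free u v) → 1 ≤ r → w * r < length Z →
    ∃[ x ] (x ∈ Z × PathFrom Rd (_∈ Z) r x)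
  levelPath f w c (suc r) {Z} uZ a free _ lt with largeLevel f w c (suc r) a lt
  ... | c′ , big with tournamentPath {R = Rd} {xs = level} (AllPairs-map∈ rd (Uniqueₚ.filter⁺ level? uZ))
    where
    level? : ∀ x → Dec (f x ≡ c′)
    level? x = f x ℕ.≟ c′
    level : List V
    level = filter level? Z
    rd : ∀ {x y} → x ∈ level → y ∈ level → x ≢ y → Rd x y ⊎ Rd y x
    rd x∈ y∈ ne with ∈-filter⁻ level? x∈ | ∈-filter⁻ level? y∈ | total ne
    ... | x∈Z , ex | y∈Z , ey | inj₁ (inj₁ b) = contradiction b (free x∈Z y∈Z ne (trans ex (sym ey)))
    ... | x∈Z , ex | y∈Z , ey | inj₁ (inj₂ b) = contradiction b (free y∈Z x∈Z (ne ∘ sym) (trans ey (sym ex)))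
    ... | _ | _ | inj₂ r = r
  ... | [] , perm , _ = contradiction (subst (suc r ≤_) (sym (↭-length perm)) big) λ ()
  ... | y ∷ ys , perm , link = y , inZ (here refl) ,
    truncate ys r (s≤s⁻¹ (subst (suc r ≤_) (sym (↭-length perm)) big)) link
      (unique-resp-↭ (↭-sym perm) (Uniqueₚ.filter⁺ _ uZ)) (All.tabulate inZ)
    where
    inZ : ∀ {v} → v ∈ y ∷ ys → v ∈ Z
    inZ v∈ = filter-⊆ _ (∈-resp-↭ perm v∈)

  -- Stop a depth-first search of the reversed red edges between X and Y when k vertices of one side
  -- are finished.  The vertices of the other side that are still open form a chain of the search
  -- tree, hence a red path; if it is short, many vertices of that side are unvisited, and they have
  -- no red edge to the finished ones, contradicting pseudorandomness.
  module Zigzag {X Y : List V} (uX : Unique X) (uY : Unique Y) (disjoint : Disjointₗ X Y)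
    (free : ∀ {x y} → x ∈ X → y ∈ Y → Free x y × Free y x) where

    D : V → V → Set
    D u v = Rd v u × ((u ∈ X × v ∈ Y) ⊎ (u ∈ Y × v ∈ X))

    D? : Decidable₂ D
    D? u v = Rd? v u ×-dec ((u ∈? X ×-dec v ∈? Y) ⊎-dec (u ∈? Y ×-dec v ∈? X))

    open DepthFirst D D?

    uXY : Unique (X ++ Y)
    uXY = Uniqueₚ.++⁺ uX uY disjoint

    module Cut (o : Ordering (X ++ Y)) (as bs : List V) (split : Ordering.ord o ≡ as ++ bs) where
      open Ordering o

      unique-ord : Unique (as ++ bs)
      unique-ord = subst Unique split (unique-resp-↭ (↭-sym perm) uXY)

      bs⊆ord : bs ⊆ ord
      bs⊆ord v∈ = subst (_ ∈_) (sym split) (∈-++⁺ʳ as v∈)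

      triple : All (λ x → AllPairs (Triple h x) bs) as
      triple = AllTriples-++⁻ as (subst (AllTriples (Triple h)) split triples)

      hit? : ∀ y → Dec (Any (λ x → D x y) as)
      hit? y = Any.any? (λ x → D? x y) as

      -- By `triple`, a vertex of `bs` that receives an edge from `as` is lower than every vertex of
      -- `bs` before it. So the hit vertices have different heights, all below `r`.
      few-hit : ∀ {r} → (∀ {v} → v ∈ ord → h v < r) → # hit? bs ≤ r
      few-hit {r} bound = subst (_≤ r) (length-map h (filter hit? bs))
        (unique-bounded-length distinct (Allₚ.map⁺ (All.tabulate λ v∈ → bound (bs⊆ord (filter-⊆ hit? v∈)))))
        where
        distinct : Unique (map h (filter hit? bs))
        distinct = AllPairsₚ.map⁺ (decreasing bs triple)
          where
          decreasing : ∀ ys → All (λ x → AllPairs (Triple h x) ys) as →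
                       AllPairs (λ u v → h u ≢ h v) (filter hit? ys)
          decreasing [] _ = []
          decreasing (y ∷ ys) t with hit? y | decreasing ys (All.map AllPairs.tail t)
          ... | no _ | ih = ih
          ... | yes _ | ih = All.tabulate (λ v∈ eq → <-irrefl (sym eq) (lower-height v∈)) ∷ ih
            where
            lower-height : ∀ {v} → v ∈ filter hit? ys → h v < h y
            lower-height v∈ with ∈-filter⁻ hit? v∈
            ... | v∈ys , hv with find hv
            ... | x , x∈ , d = All.lookup (AllPairs.head (All.lookup t x∈)) v∈ys d

      -- P and Q are the two sides, in either order.
      absurd : {P Q : V → Set} (P? : Decidable P) (Q? : Decidable Q) →
        (∀ {u v} → P u → Q v → Free v u × (Rd v u → D u v)) → (∀ {v} → P v → Q v → ⊥) →
        ∀ {r} → (∀ {v} → v ∈ ord → h v < r) → k ≤ # P? as → # Q? as ≤ k → r + (k + k) ≤ # Q? ord → ⊥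
      absurd {P} {Q} P? Q? cross disj {r} bound big small enough with
        redEdge (Uniqueₚ.filter⁺ fresh? ub) (Uniqueₚ.filter⁺ P? ua) dis many big free′
        where
        fresh? : ∀ v → Dec (Q v × ¬ Any (λ x → D x v) as)
        fresh? v = Q? v ×-dec ¬? (hit? v)
        ua : Unique as
        ua = proj₁ (AllPairs-++⁻ as unique-ord)
        ub : Unique bs
        ub = proj₁ (proj₂ (AllPairs-++⁻ as unique-ord))
        dis : Disjointₗ (filter fresh? bs) (filter P? as)
        dis (v∈ , v∈′) = disj (proj₂ (∈-filter⁻ P? {xs = as} v∈′)) (proj₁ (proj₂ (∈-filter⁻ fresh? {xs = bs} v∈)))
        free′ : ∀ {v u} → v ∈ filter fresh? bs → u ∈ filter P? as → Free v u
        free′ v∈ u∈ = proj₁ (cross (proj₂ (∈-filter⁻ P? {xs = as} u∈)) (proj₁ (proj₂ (∈-filter⁻ fresh? {xs = bs} v∈))))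
        Q-split : # Q? bs ≤ # hit? bs + # fresh? bs
        Q-split = ≤-trans (cover hit? fresh? {filter Q? bs} classify) (+-mono-≤ (#-filter hit? Q? bs) (#-filter fresh? Q? bs))
          where
          classify : ∀ {v} → v ∈ filter Q? bs → Any (λ x → D x v) as ⊎ (Q v × ¬ Any (λ x → D x v) as)
          classify {v} v∈ with hit? v
          ... | yes p = inj₁ p
          ... | no np = inj₂ (proj₂ (∈-filter⁻ Q? {xs = bs} v∈) , np)
        -- Of at least r + 2k vertices of side `Q`, at most `k` are in `as` and at most `r` are hit.
        -- The other `k` are fresh, and a red edge from one of them to a `P`-vertex of `as` would be
        -- a hit.
        many : k ≤ # fresh? bs
        many = +-cancelˡ-≤ (r + k) k _ (begin
          (r + k) + k                       ≡⟨ +-assoc r k k ⟩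
          r + (k + k)                       ≤⟨ enough ⟩
          # Q? ord                          ≡⟨ trans (cong (# Q?) split) (#-++ Q? as) ⟩
          # Q? as + # Q? bs                 ≤⟨ +-mono-≤ small (≤-trans Q-split (+-monoˡ-≤ _ (few-hit bound))) ⟩
          k + (r + # fresh? bs)             ≡⟨ solveIt k r (# fresh? bs) ⟩
          (r + k) + # fresh? bs             ∎)
          where
          open ≤-Reasoning
          solveIt : ∀ a b c → a + (b + c) ≡ (b + a) + c
          solveIt = solve-∀
      ... | v , u , v∈ , u∈ , rd with ∈-filter⁻ (λ v → Q? v ×-dec ¬? (hit? v)) {xs = bs} v∈ | ∈-filter⁻ P? {xs = as} u∈
      ... | _ , qv , nohit | u∈as , pu = nohit (lose u∈as (proj₂ (cross pu qv) rd))

    zigzag : ∀ r → 1 ≤ r → r + (k + k) ≤ length X → r + (k + k) ≤ length Y →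
             ∃[ x ] (x ∈ X × PathFrom Rd (λ v → v ∈ X ⊎ v ∈ Y) r x)
    zigzag (suc r) _ lx ly with ordering _≟_ (X ++ Y) uXY
    ... | o with Any.any? (λ v → suc r ≤? Ordering.h o v) (Ordering.ord o)
    ... | yes long = start (find long)
      where
      open Ordering o
      side : ∀ {v} → v ∈ ord → v ∈ X ⊎ v ∈ Y
      side v∈ = ∈-++⁻ X (∈-resp-↭ perm v∈)
      start : ∃[ v ] (v ∈ ord × suc r ≤ h v) → ∃[ x ] (x ∈ X × PathFrom Rd (λ v → v ∈ X ⊎ v ∈ Y) (suc r) x)
      start (v , v∈ , le) with paths v∈ | side v∈
      ... | q , len , link , u , inside | inj₁ v∈X = v , v∈X , truncate q r
        (≤-trans (n≤1+n r) (subst (suc r ≤_) (sym len) le)) (Linked.map proj₁ link) u (All.map side inside)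
      ... | [] , len , _ | inj₂ _ = contradiction (subst (suc r ≤_) (sym len) le) λ ()
      ... | x ∷ q , len , (_ , inj₁ (x∈X , _)) ∷ link , _ ∷ u , _ ∷ inside | inj₂ v∈Y = x , x∈X , truncate q r
        (s≤s⁻¹ (subst (suc r ≤_) (sym len) le)) (Linked.map proj₁ link) u (All.map side inside)
      ... | x ∷ q , len , (_ , inj₂ (_ , v∈X)) ∷ link , _ ∷ u , _ ∷ inside | inj₂ v∈Y = contradiction (v∈X , v∈Y) disjoint
    ... | no short with cut (_∈? X) (_∈? Y) k k (Ordering.ord o)
                        (≤-trans (≤-trans (m≤m+n k k) (m≤n+m (k + k) (suc r))) (≤-trans lx count-X))
      where
      open Ordering o
      count-X : length X ≤ # (_∈? X) ord
      count-X = unique-⊆-length uX λ v∈ → ∈-filter⁺ (_∈? X) (∈-resp-↭ (↭-sym perm) (∈-++⁺ˡ v∈)) v∈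
    ... | as , bs , split , which = ⊥-elim (stuck which)
      where
      open Ordering o
      open Cut o as bs split
      bound : ∀ {v} → v ∈ ord → h v < suc r
      bound {v} v∈ = ≰⇒> λ le → short (lose v∈ le)
      count : ∀ {Z} → Unique Z → Z ⊆ X ++ Y → length Z ≤ # (_∈? Z) ord
      count {Z} uZ sub = unique-⊆-length uZ λ v∈ → ∈-filter⁺ (_∈? Z) (∈-resp-↭ (↭-sym perm) (sub v∈)) v∈
      stuck : (# (_∈? X) as ≡ k × # (_∈? Y) as ≤ k) ⊎ (# (_∈? Y) as ≡ k × # (_∈? X) as ≤ k) → ⊥
      stuck (inj₁ (eq , le)) = absurd (_∈? X) (_∈? Y)
        (λ u∈ v∈ → proj₂ (free u∈ v∈) , λ e → e , inj₁ (u∈ , v∈)) (λ u∈ v∈ → disjoint (u∈ , v∈))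
        bound (≤-reflexive (sym eq)) le (≤-trans ly (count uY (∈-++⁺ʳ X)))
      stuck (inj₂ (eq , le)) = absurd (_∈? Y) (_∈? X)
        (λ u∈ v∈ → proj₁ (free v∈ u∈) , λ e → e , inj₂ (u∈ , v∈)) (λ u∈ v∈ → disjoint (v∈ , u∈))
        bound (≤-reflexive (sym eq)) le (≤-trans lx (count uX ∈-++⁺ˡ))


  -- Units and the red edges between them

  module Units (ℓ : ℕ) (ℓ≤2k : ℓ ≤ k + k) where

    Starts : List V → List V → ℕ → List V → Set
    Starts carrier bad r S = ∃[ xs ] (Unique xs × k ≤ length xs × xs ⊆ S ×
      All (PathFrom Rd (λ v → v ∈ carrier × v ∉ bad) r) xs)

    -- A chunk of `r` vertices is hosted by a red path in `carrier` that starts in `left` or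
    -- `right`; `bad` will be the vertices without a red edge to some child.
    record Unit : Set where
      field
        left right carrier : List V
        unique : Unique carrier
        left⊆ : left ⊆ carrier
        right⊆ : right ⊆ carrier
        rich : ∀ bad r → length bad < k + k → 1 ≤ r → r ≤ ℓ →
               Starts carrier bad r left × Starts carrier bad r right
    open Unit

    good? : (bad : List V) → ∀ v → Dec (v ∉ bad)
    good? bad v = ¬? (v ∈? bad)

    few-bad : ∀ bad {S m} → Unique S → length bad < k + k → (k + k) + m ≤ length S → m ≤ # (good? bad) S
    few-bad bad {S} {m} uS few le = +-cancelˡ-≤ (k + k) m _ (begin
      (k + k) + m                                 ≤⟨ le ⟩
      length S                                    ≤⟨ complement (_∈? bad) S ⟩
      # (_∈? bad) S + # (good? bad) S             ≤⟨ +-monoˡ-≤ _ (≤-trans bad-count (<⇒≤ few)) ⟩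
      (k + k) + # (good? bad) S                   ∎)
      where
      open ≤-Reasoning
      bad-count : # (_∈? bad) S ≤ length bad
      bad-count = unique-⊆-length (Uniqueₚ.filter⁺ (_∈? bad) uS) (λ v∈ → proj₂ (∈-filter⁻ (_∈? bad) {xs = S} v∈))

    levelUnit : (f : V → ℕ) (w c : ℕ) (U : List V) → Unique U → All (λ x → c ≤ f x × f x < c + w) U →
      (∀ {u v} → u ∈ U → v ∈ U → u ≢ v → f u ≡ f v → Free u v) → w * ℓ ≤ k + k → levelSize ≤ length U → Unit
    levelUnit f w c U uU range free wℓ big = record
      { left = U ; right = U ; carrier = U ; unique = uU ; left⊆ = id ; right⊆ = id
      ; rich = λ bad r few 1≤r r≤ℓ → let s = starts bad r few 1≤r r≤ℓ in s , s }
      where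
      starts : ∀ bad r → length bad < k + k → 1 ≤ r → r ≤ ℓ → Starts U bad r U
      -- Any `suc (w * r)` good vertices contain a start. Of 6k vertices fewer than 2k are bad,
      -- `w * r` takes up to 2k, the successor at most `k`, and the `k` starts themselves another
      -- `k`.
      starts bad r few 1≤r r≤ℓ with manyStarts _≟_ {P = PathFrom Rd (λ v → v ∈ U × v ∉ bad) r}
          (suc (w * r)) (filter (good? bad) U) (Uniqueₚ.filter⁺ _ uU) path k enough
        where
        path : ∀ Z → Unique Z → Z ⊆ filter (good? bad) U → suc (w * r) ≤ length Z →
               ∃[ x ] (x ∈ Z × PathFrom Rd (λ v → v ∈ U × v ∉ bad) r x)
        path Z uZ sub le with levelPath f w c r uZ
          (All.tabulate λ v∈ → All.lookup range (filter-⊆ _ (sub v∈)))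
          (λ u∈ v∈ → free (filter-⊆ _ (sub u∈)) (filter-⊆ _ (sub v∈))) 1≤r le
        ... | x , x∈ , p = x , x∈ , PathFrom-map id (λ v∈ → ∈-filter⁻ (good? bad) (sub v∈)) p
        enough : suc (w * r) + k ≤ # (good? bad) U
        enough = few-bad bad uU few (≤-trans (+-monoʳ-≤ (k + k)
          (≤-trans (≤-reflexive (sym (+-suc (w * r) k)))
            (+-mono-≤ (≤-trans (*-monoʳ-≤ w r≤ℓ) wℓ) (+-monoˡ-≤ k 1≤k)))) big)
      ... | xs , ux , len , sub , a = xs , ux , ≤-reflexive (sym len) , filter-⊆ _ ∘ sub , a

    pairUnit : (X Y : List V) → Unique X → Unique Y → Disjointₗ X Y →
      (∀ {x y} → x ∈ X → y ∈ Y → Free x y × Free y x) →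
      pairSize ≤ length X → pairSize ≤ length Y → Unit
    pairUnit X Y uX uY disjoint free bigX bigY = record
      { left = X ; right = Y ; carrier = X ++ Y ; unique = Uniqueₚ.++⁺ uX uY disjoint
      ; left⊆ = ∈-++⁺ˡ ; right⊆ = ∈-++⁺ʳ X
      ; rich = λ bad r few 1≤r r≤ℓ →
          starts uX uY disjoint free bigX bigY [ ∈-++⁺ˡ , ∈-++⁺ʳ X ]′ bad r few 1≤r r≤ℓ ,
          starts uY uX (disjoint ∘ λ (a , b) → b , a) (λ y∈ x∈ → let a , b = free x∈ y∈ in b , a) bigY bigX
            [ ∈-++⁺ʳ X , ∈-++⁺ˡ ]′ bad r few 1≤r r≤ℓ }
      where
      starts : ∀ {X Y C} → Unique X → Unique Y → Disjointₗ X Y →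
        (∀ {x y} → x ∈ X → y ∈ Y → Free x y × Free y x) →
        pairSize ≤ length X → pairSize ≤ length Y →
        (∀ {v} → v ∈ X ⊎ v ∈ Y → v ∈ C) →
        ∀ bad r → length bad < k + k → 1 ≤ r → r ≤ ℓ → Starts C bad r X
      starts {X} {Y} {C} uX uY disjoint free bigX bigY inC bad r few 1≤r r≤ℓ
        -- Of 7k vertices fewer than 2k are bad, `zigzag` needs at most 4k, and `k` starts are
        -- removed one after another.
        with manyStarts _≟_ {P = PathFrom Rd (λ v → v ∈ C × v ∉ bad) r}
          (r + (k + k)) (filter (good? bad) X) (Uniqueₚ.filter⁺ _ uX) path k
          (≤-trans (+-monoˡ-≤ k (+-monoˡ-≤ (k + k) (≤-trans r≤ℓ ℓ≤2k))) (few-bad bad uX few bigX))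
        where
        path : ∀ Z → Unique Z → Z ⊆ filter (good? bad) X → r + (k + k) ≤ length Z →
               ∃[ x ] (x ∈ Z × PathFrom Rd (λ v → v ∈ C × v ∉ bad) r x)
        path Z uZ sub le with Zigzag.zigzag uZ (Uniqueₚ.filter⁺ (good? bad) uY)
          (λ (a , b) → disjoint (filter-⊆ _ (sub a) , filter-⊆ _ b))
          (λ x∈ y∈ → free (filter-⊆ _ (sub x∈)) (filter-⊆ _ y∈)) r 1≤r le
          (≤-trans (+-monoˡ-≤ (k + k) (≤-trans r≤ℓ ℓ≤2k)) (≤-trans (m≤m+n _ k) (few-bad bad uY few bigY)))
        ... | x , x∈ , p = x , x∈ , PathFrom-map id
          [ (λ v∈ → let a , b = ∈-filter⁻ (good? bad) (sub v∈) in inC (inj₁ a) , b) ,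
            (λ v∈ → let a , b = ∈-filter⁻ (good? bad) {xs = Y} v∈ in inC (inj₂ a) , b) ]′ p
      ... | xs , ux , len , sub , a = xs , ux , ≤-reflexive (sym len) , filter-⊆ _ ∘ sub , a

    Sees : V → Unit → Set
    Sees v u = (∀ {y} → y ∈ left u → Free v y) ⊎ (∀ {y} → y ∈ right u → Free v y)

    Before : Unit → Unit → Set
    Before q p = (∀ {v} → v ∈ carrier q → Sees v p) × Disjointₗ (carrier q) (carrier p)

    -- The possible images of the root of a subtree that is already placed. Both sides are kept
    -- because an earlier vertex may see only one of them.
    record Target : Set where
      field
        unit : Unit
        xl xr : List V
        ul : Unique xl
        ur : Unique xr
        xl⊆ : xl ⊆ left unit
        xr⊆ : xr ⊆ right unit
        kl : k ≤ length xl
        kr : k ≤ length xr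
    open Target

    Hit : V → Target → Set
    Hit v t = Any (Rd v) (xl t ++ xr t)

    hit? : ∀ v t → Dec (Hit v t)
    hit? v t = Any.any? (Rd? v) (xl t ++ xr t)

    -- The vertices are split by the side that they see. If `k` of them see the same side, `joined`
    -- gives an edge to a start on that side; it is not blue, hence red.
    few-miss : ∀ t {E} → Unique E → (∀ {v} → v ∈ E → Sees v (unit t)) → Disjointₗ E (carrier (unit t)) →
               All (λ v → ¬ Hit v t) E → length E < k + k
    few-miss t {E} uE sees dis miss with splitSum uE sees
    ... | ys , zs , uy , uz , sy , sz , py , qz , len with k ≤? length ys | k ≤? length zs
    ... | no a | no b = subst (_< k + k) len (+-mono-< (≰⇒> a) (≰⇒> b))
    ... | yes le | _ with redEdge uy (ul t) (λ (a , b) → dis (sy a , left⊆ (unit t) (xl⊆ t b))) le (kl t)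
                          (λ v∈ y∈ → All.lookup py v∈ (xl⊆ t y∈))
    ... | v , y , v∈ , y∈ , rd = contradiction (lose (∈-++⁺ˡ y∈) rd) (All.lookup miss (sy v∈))
    few-miss t {E} uE sees dis miss | ys , zs , uy , uz , sy , sz , py , qz , len | no _ | yes le
      with redEdge uz (ur t) (λ (a , b) → dis (sz a , right⊆ (unit t) (xr⊆ t b))) le (kr t)
                          (λ v∈ y∈ → All.lookup qz v∈ (xr⊆ t y∈))
    ... | v , y , v∈ , y∈ , rd = contradiction (lose (∈-++⁺ʳ (xl t) y∈) rd) (All.lookup miss (sz v∈))

    vertices : List Unit → List V
    vertices us = concat (map carrier us)

    In : List Unit → V → Set
    In us v = Any (λ u → v ∈ carrier u) us

    vertices⇒In : ∀ us {v} → v ∈ vertices us → In us v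
    vertices⇒In us v∈ = Anyₚ.map⁻ (Anyₚ.concat⁻ (map carrier us) v∈)

    vertices-unique : ∀ {us} → AllPairs Before us → Unique (vertices us)
    vertices-unique {us} bf = Uniqueₚ.concat⁺ (Allₚ.map⁺ (All.tabulate λ {u} _ → unique u)) (AllPairsₚ.map⁺ (AllPairs.map proj₂ bf))

    missing? : ∀ ts v → Dec (Any (λ t → ¬ Hit v t) ts)
    missing? ts v = Any.any? (λ t → ¬? (hit? v t)) ts

    few-missing : ∀ I ts → AllPairs Before I → All (λ u → All (λ t → Before u (unit t)) ts) I →
                  # (missing? ts) (vertices I) ≤ length ts * (k + k)
    few-missing I [] _ _ = ≤-reflexive (cong length (filter-none (missing? []) {xs = vertices I} (All.tabulate λ _ ())))
    few-missing I (t ∷ ts) bI b = ≤-trans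
      (#-sub (missing? (t ∷ ts)) (λ v → ¬? (hit? v t)) (missing? ts) (vertices I) (λ { (here p) → inj₁ p ; (there p) → inj₂ p }))
      (+-mono-≤ (<⇒≤ (few-miss t (Uniqueₚ.filter⁺ miss? (vertices-unique bI)) sees dis (filter-All miss? {vertices I})))
        (few-missing I ts bI (All.map All.tail b)))
      where
      miss? : ∀ v → Dec (¬ Hit v t)
      miss? v = ¬? (hit? v t)
      before : ∀ {v} → v ∈ filter miss? (vertices I) → Sees v (unit t) × v ∉ carrier (unit t)
      before v∈ with find (vertices⇒In I (filter-⊆ miss? v∈))
      ... | u , u∈ , v∈u with All.lookup b u∈
      ... | (s , d) ∷ _ = s v∈u , λ v∈t → d (v∈u , v∈t)
      sees : ∀ {v} → v ∈ filter miss? (vertices I) → Sees v (unit t)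
      sees v∈ = proj₁ (before v∈)
      dis : Disjointₗ (filter miss? (vertices I)) (carrier (unit t))
      dis (v∈ , v∈t) = proj₂ (before v∈) v∈t

    -- Averaging: each target is missed by fewer than 2k vertices in all units together, so if there
    -- are more units than targets, some unit has fewer than 2k vertices that miss a target.
    goodUnit : ∀ I ts → AllPairs Before I → All (λ u → All (λ t → Before u (unit t)) ts) I → length ts < length I →
               ∃[ u ] (u ∈ I × # (missing? ts) (carrier u) < k + k)
    goodUnit I ts bI b len with Any.any? (λ u → # (missing? ts) (carrier u) <? k + k) I
    ... | yes a = find a
    ... | no none = contradiction (≤-trans (total-missing I (Allₚ.¬Any⇒All¬ I none)) (few-missing I ts bI b))
      (<⇒≱ (*-monoˡ-< (k + k) {{>-nonZero (≤-trans 1≤k (m≤m+n k k))}} len))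
      where
      total-missing : ∀ J → All (λ u → ¬ (# (missing? ts) (carrier u) < k + k)) J → length J * (k + k) ≤ # (missing? ts) (vertices J)
      total-missing [] _ = z≤n
      total-missing (u ∷ J) (nu ∷ a) = subst (_ ≤_) (sym (#-++ (missing? ts) (carrier u)))
        (+-mono-≤ (≮⇒≥ nu) (total-missing J a))

    -- Placing a chunked tree on a sequence of units

    module Placement {A : Set} where

      Placed : Chunk A → List Unit → Set
      Placed κ us = ∃[ t ] (unit t ∈ us × All (λ x → Embedding Rd κ x (In us)) (xl t ++ xr t))

      PlacedAll : List (Chunk A) → List Unit → Set
      PlacedAll [] us = ⊤
      PlacedAll (κ ∷ ks) us = ∃[ us₁ ] ∃[ us₂ ] (us ≡ us₁ ++ us₂ × Placed κ us₁ × PlacedAll ks us₂)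

      targets : ∀ ks {us} → PlacedAll ks us → List Target
      targets [] _ = []
      targets (κ ∷ ks) (_ , _ , _ , (t , _) , rest) = t ∷ targets ks rest

      length-targets : ∀ ks {us} (p : PlacedAll ks us) → length (targets ks p) ≡ length ks
      length-targets [] _ = refl
      length-targets (κ ∷ ks) (_ , _ , _ , _ , rest) = cong suc (length-targets ks rest)

      targets-∈ : ∀ ks {us} (p : PlacedAll ks us) → All (λ t → unit t ∈ us) (targets ks p)
      targets-∈ [] _ = []
      targets-∈ (κ ∷ ks) (us₁ , us₂ , refl , (t , t∈ , _) , rest) =
        ∈-++⁺ˡ t∈ ∷ All.map (∈-++⁺ʳ us₁) (targets-∈ ks rest)

      record EmbedsAll (ks : List (Chunk A)) (y : V) (Ok : V → Set) : Set where
        field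
          ψ : List (A × V)
          keys : map proj₁ ψ ≡ labelss ks
          injective : Unique (map proj₂ ψ)
          inside : All Ok (map proj₂ ψ)
          roots : ∀ {κ} → κ ∈ ks → ∃[ b ] ((root κ , b) ∈ ψ × Rd y b)
          arcs : ∀ {κ u v} → κ ∈ ks → Arc κ u v → ∃[ a ] ∃[ b ] ((u , a) ∈ ψ × (v , b) ∈ ψ × Rd a b)

      In-disjoint : ∀ us₁ {us₂ v} → AllPairs Before (us₁ ++ us₂) → In us₁ v → In us₂ v → ⊥
      In-disjoint us₁ bf in₁ in₂ with find in₁ | find in₂ | proj₂ (proj₂ (AllPairs-++⁻ us₁ bf))
      ... | u , u∈ , v∈u | u′ , u′∈ , v∈u′ | cross = proj₂ (All.lookup (All.lookup cross u∈) u′∈) (v∈u , v∈u′)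

      unique-join : ∀ us₁ {us₂ xs ys} → AllPairs Before (us₁ ++ us₂) → Unique xs → Unique ys →
                    All (In us₁) xs → All (In us₂) ys → Unique (xs ++ ys)
      unique-join us₁ bf ux uy ix iy = Uniqueₚ.++⁺ ux uy λ (v∈ , v∈′) →
        In-disjoint us₁ bf (All.lookup ix v∈) (All.lookup iy v∈′)

      embedAll : ∀ ks {us} (p : PlacedAll ks us) y → AllPairs Before us → All (Hit y) (targets ks p) → EmbedsAll ks y (In us)
      embedAll [] p y bf hits = record { ψ = [] ; keys = refl ; injective = [] ; inside = [] ; roots = λ () ; arcs = λ () }
      embedAll (κ ∷ ks) (us₁ , us₂ , refl , (t , _ , embs) , rest) y bf (hit ∷ hits) with find hit
      ... | b , b∈ , rd with All.lookup embs b∈ | embedAll ks rest y (proj₁ (proj₂ (AllPairs-++⁻ us₁ bf))) hits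
      ... | e | es = record
        { ψ = E.ψ ++ Es.ψ
        ; keys = trans (map-++ proj₁ E.ψ Es.ψ) (cong₂ _++_ E.keys Es.keys)
        ; injective = subst Unique (sym (map-++ proj₂ E.ψ Es.ψ)) (unique-join us₁ bf E.injective Es.injective E.inside Es.inside)
        ; inside = subst (All _) (sym (map-++ proj₂ E.ψ Es.ψ))
            (Allₚ.++⁺ (All.map Anyₚ.++⁺ˡ E.inside) (All.map (Anyₚ.++⁺ʳ us₁) Es.inside))
        ; roots = λ { (here refl) → b , ∈-++⁺ˡ E.rooted , rd
                    ; (there κ∈) → let b , b∈ , r = Es.roots κ∈ in b , ∈-++⁺ʳ E.ψ b∈ , r }
        ; arcs = λ { (here refl) arc → let a , b , a∈ , b∈ , r = E.arcs arc in a , b , ∈-++⁺ˡ a∈ , ∈-++⁺ˡ b∈ , r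
                   ; (there κ∈) arc → let a , b , a∈ , b∈ , r = Es.arcs κ∈ arc in a , b , ∈-++⁺ʳ E.ψ a∈ , ∈-++⁺ʳ E.ψ b∈ , r } }
        where
        module E = Embedding e
        module Es = EmbedsAll es

      lay : ∀ (a : A) as x q → length q ≡ length as → Linked Rd (x ∷ q) →
        ∃[ ψ ] (map proj₁ ψ ≡ a ∷ as × map proj₂ ψ ≡ x ∷ q × (a , x) ∈ ψ × (final a as , final x q) ∈ ψ ×
          (∀ {u v} → Consecutive a as u v → ∃[ s ] ∃[ t ] ((u , s) ∈ ψ × (v , t) ∈ ψ × Rd s t)))
      lay a [] x [] _ _ = (a , x) ∷ [] , refl , refl , here refl , here refl , λ ()
      lay a (b ∷ as) x (y ∷ q) len (xy ∷ link) with lay b as y q (suc-injective len) link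
      ... | ψ , ks , vs , top , bot , arcs = (a , x) ∷ ψ , cong (a ∷_) ks , cong (x ∷_) vs , here refl , there bot ,
        λ { first → x , y , here refl , there top , xy
          ; (later c) → let s , t , s∈ , t∈ , r = arcs c in s , t , there s∈ , there t∈ , r }

      -- The children are placed first, in the later units `rest`. The top path then goes to one of
      -- the first `suc (length ks)` units, all of which are `Before` the units of the children.
      place : ∀ κ us → AllPairs Before us → Short ℓ κ → cost κ ≤ length us → Placed κ us
      placeAll : ∀ ks us → AllPairs Before us → Shorts ℓ ks → costs ks ≤ length us → PlacedAll ks us

      placeAll [] us _ _ _ = tt
      placeAll (κ ∷ ks) us bf (sκ , sks) le with take (cost κ) us | drop (cost κ) us | take++drop≡id (cost κ) us
          | length-take (cost κ) us | length-drop (cost κ) us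
      ... | us₁ | us₂ | refl | len₁ | len₂ with AllPairs-++⁻ us₁ bf
      ... | bf₁ , bf₂ , _ = us₁ , us₂ , refl ,
        place κ us₁ bf₁ sκ (≤-reflexive (sym (trans len₁ (m≤n⇒m⊓n≡m (≤-trans (m≤m+n _ _) le))))) ,
        placeAll ks us₂ bf₂ sks (subst (costs ks ≤_) (sym len₂)
          (+-cancelˡ-≤ (cost κ) _ _ (≤-trans le (≤-reflexive (sym (m+[n∸m]≡n (≤-trans (m≤m+n (cost κ) (costs ks)) le)))))))

      place (chunk a as ks) us bf (short , sks) le with take (suc (length ks)) us | drop (suc (length ks)) us
          | take++drop≡id (suc (length ks)) us | length-take (suc (length ks)) us | length-drop (suc (length ks)) us
      ... | I | rest | refl | len₁ | len₂ with AllPairs-++⁻ I bf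
      ... | bI , brest , cross with placeAll ks rest brest sks (subst (costs ks ≤_) (sym len₂)
          (+-cancelˡ-≤ (suc (length ks)) _ _ (≤-trans le (≤-reflexive (sym (m+[n∸m]≡n (≤-trans (m≤m+n (suc (length ks)) (costs ks)) le)))))))
      ... | p with goodUnit I (targets ks p) bI
            (All.map (λ c → All.map (All.lookup c) (targets-∈ ks p)) cross)
            (≤-reflexive (trans (cong suc (length-targets ks p)) (sym (trans len₁ (m≤n⇒m⊓n≡m (≤-trans (m≤m+n _ _) le))))))
      -- Since the vertices that miss some child are declared bad, the last vertex of the path has a
      -- red edge to a start of every child.
      ... | u , u∈ , few with rich u (filter (missing? (targets ks p)) (carrier u)) (suc (length as)) few (s≤s z≤n) short
      ... | (xl , ul , kl , xl⊆ , el) , (xr , ur , kr , xr⊆ , er) =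
        record { unit = u ; xl = xl ; xr = xr ; ul = ul ; ur = ur ; xl⊆ = xl⊆ ; xr⊆ = xr⊆ ; kl = kl ; kr = kr } ,
        ∈-++⁺ˡ u∈ , Allₚ.++⁺ (All.map embed el) (All.map embed er)
        where
        bad : List V
        bad = filter (missing? (targets ks p)) (carrier u)
        final-∈ : ∀ x q → final x q ∈ x ∷ q
        final-∈ x [] = here refl
        final-∈ x (y ∷ q) = there (final-∈ y q)
        embed : ∀ {x} → PathFrom Rd (λ v → v ∈ carrier u × v ∉ bad) (suc (length as)) x →
                Embedding Rd (chunk a as ks) x (In (I ++ rest))
        embed {x} (q , len , link , uq , ok) with lay a as x q (suc-injective len) link
        ... | ψ , ψkeys , ψvals , top , bot , consec with embedAll ks p (final x q) brest hits
          where
          hits : All (Hit (final x q)) (targets ks p)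
          hits = All.tabulate λ {t} t∈ → decidable-stable (hit? (final x q) t) λ nh →
            let c , nb = All.lookup ok (final-∈ x q) in
            nb (∈-filter⁺ (missing? (targets ks p)) c (lose t∈ nh))
        ... | es = record
          { ψ = ψ ++ Es.ψ
          ; keys = trans (map-++ proj₁ ψ Es.ψ) (cong₂ _++_ ψkeys Es.keys)
          ; injective = subst Unique (sym (map-++ proj₂ ψ Es.ψ))
              (unique-join I bf (subst Unique (sym ψvals) uq) Es.injective inI Es.inside)
          ; inside = subst (All _) (sym (map-++ proj₂ ψ Es.ψ))
              (Allₚ.++⁺ (All.map Anyₚ.++⁺ˡ inI) (All.map (Anyₚ.++⁺ʳ I) Es.inside))
          ; rooted = ∈-++⁺ˡ top
          ; arcs = λ { (along c) → let s , t , s∈ , t∈ , r = consec c in s , t , ∈-++⁺ˡ s∈ , ∈-++⁺ˡ t∈ , r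
                     ; (down κ∈) → let b , b∈ , r = Es.roots κ∈ in final x q , b , ∈-++⁺ˡ bot , ∈-++⁺ʳ ψ b∈ , r
                     ; (child κ∈ arc) → let s , t , s∈ , t∈ , r = Es.arcs κ∈ arc in s , t , ∈-++⁺ʳ ψ s∈ , ∈-++⁺ʳ ψ t∈ , r } }
          where
          module Es = EmbedsAll es
          inI : All (In I) (map proj₂ ψ)
          inI = subst (All (In I)) (sym ψvals) (All.map (λ (c , _) → lose u∈ c) ok)

    -- Units from blocks of the finishing order

    module Blocks {xs : List V} (uxs : Unique xs) (o : DepthFirst.Ordering Bl Bl? xs)
      (n : ℕ) (h<n : ∀ {v} → v ∈ DepthFirst.Ordering.ord o → DepthFirst.Ordering.h o v < n)
      (w : ℕ) (1≤w : 1 ≤ w) (wℓ : w * ℓ ≤ k + k) (L t : ℕ)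
      (large : (pairSize + pairSize) + (w + levelSize) ≤ L)
      (fits : t * L ≤ length xs) where

      open DepthFirst.Ordering o
      open Index _≟_

      s : ℕ
      s = pairSize

      1≤s : 1 ≤ s
      1≤s = ≤-trans 1≤k (≤-trans (m≤m+n k k) (m≤m+n _ _))

      idx : V → ℕ
      idx = index _≟_ ord

      uord : Unique ord
      uord = unique-resp-↭ (↭-sym perm) uxs

      block : ℕ → List V
      block a = take L (drop (a * L) ord)

      block⊆ : ∀ {a} → block a ⊆ ord
      block⊆ {a} v∈ = subst (_ ∈_) (take++drop≡id (a * L) ord) (∈-++⁺ʳ (take (a * L) ord)
        (subst (_ ∈_) (take++drop≡id L (drop (a * L) ord)) (∈-++⁺ˡ v∈)))

      block-unique : ∀ a → Unique (block a)
      block-unique a = Uniqueₚ.take⁺ L (Uniqueₚ.drop⁺ (a * L) uord)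

      block-length : ∀ {a} → a < t → length (block a) ≡ L
      block-length {a} a<t = trans (length-take L _) (m≤n⇒m⊓n≡m (subst (L ≤_) (sym (length-drop (a * L) ord))
        (m+n≤o⇒m≤o∸n L (≤-trans (*-monoˡ-≤ L a<t) (subst (t * L ≤_) (sym (↭-length perm)) fits)))))

      block-lower : ∀ {a v} → v ∈ block a → a * L ≤ idx v
      block-lower {a} v∈ = index-drop (a * L) uord (subst (_ ∈_) (take++drop≡id L (drop (a * L) ord)) (∈-++⁺ˡ v∈))

      block-upper : ∀ {a v} → v ∈ block a → idx v < suc a * L
      block-upper {a} v∈ = <-≤-trans (index-take (a * L) L v∈) (≤-reflexive (+-comm (a * L) L))

      block-order : ∀ {a b u v} → a < b → u ∈ block a → v ∈ block b → idx u < idx v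
      block-order {a} {b} a<b u∈ v∈ = <-≤-trans (block-upper {a} u∈) (≤-trans (*-monoˡ-≤ L a<b) (block-lower {b} v∈))

      block-disjoint : ∀ {a b v} → v ∈ block a → v ∈ block b → a ≡ b
      block-disjoint {a} {b} v∈ v∈′ with <-cmp a b
      ... | tri< lt _ _ = contradiction (block-order {a} {b} lt v∈ v∈′) (n≮n _)
      ... | tri≈ _ eq _ = eq
      ... | tri> _ _ gt = contradiction (block-order {b} {a} gt v∈′ v∈) (n≮n _)

      pair : ∀ {u v} → u ∈ ord → v ∈ ord → idx u < idx v → Bl u v ⊎ Bl v u → h v < h u
      pair u∈ v∈ lt = index-pairs pairs u∈ v∈ lt

      triple : ∀ {u z v} → u ∈ ord → z ∈ ord → v ∈ ord → idx u < idx z → idx z < idx v → Bl u v → h v < h z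
      triple u∈ z∈ v∈ lt lt′ = index-triples triples u∈ z∈ v∈ lt lt′

      high? : ∀ j v → Dec (j * w ≤ h v)
      high? j v = j * w ≤? h v

      low? : ∀ j v → Dec (h v ≤ j * w)
      low? j v = h v ≤? j * w

      -- The largest class up to the given bound with at least `s` vertices of the block at or above
      -- its lower end. The default 0 is sound because every block has at least `s` vertices.
      searchClass : ℕ → ℕ → ℕ
      searchClass a zero = 0
      searchClass a (suc j) with s ≤? # (high? (suc j)) (block a)
      ... | yes _ = suc j
      ... | no _ = searchClass a j

      class : ℕ → ℕ
      class a = searchClass a n

      above-class : ∀ a m {j} → searchClass a m < j → j ≤ m → # (high? j) (block a) < s
      above-class a zero () z≤n
      above-class a (suc m) {j} lt le with s ≤? # (high? (suc m)) (block a)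
      ... | yes _ = contradiction le (<⇒≱ lt)
      ... | no few with m≤n⇒m<n∨m≡n le
      ... | inj₁ j<m = above-class a m lt (s≤s⁻¹ j<m)
      ... | inj₂ refl = ≰⇒> few

      class-high : ∀ {a} → a < t → s ≤ # (high? (class a)) (block a)
      class-high {a} a<t = go n
        where
        go : ∀ m → s ≤ # (high? (searchClass a m)) (block a)
        go zero = begin
          s                           ≤⟨ m≤m+n s s ⟩
          s + s                       ≤⟨ m≤m+n (s + s) _ ⟩
          _                           ≤⟨ large ⟩
          L                           ≡⟨ block-length a<t ⟨
          length (block a)            ≡⟨ cong length (filter-all (high? 0) {xs = block a} (All.tabulate λ _ → z≤n)) ⟨
          # (high? 0) (block a)       ∎
          where open ≤-Reasoning
        go (suc m) with s ≤? # (high? (suc m)) (block a)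
        ... | yes p = p
        ... | no _ = go m

      class-next : ∀ a → # (high? (suc (class a))) (block a) < s
      class-next a with suc (class a) ≤? n
      ... | yes le = above-class a n ≤-refl le
      ... | no nle = subst (_< s) (sym (cong length (filter-none (high? (suc (class a))) {xs = block a} (All.tabulate none)))) 1≤s
        where
        none : ∀ {v} → v ∈ block a → ¬ (suc (class a) * w ≤ h v)
        none v∈ le = contradiction (≤-trans (s≤s (≤-trans le (<⇒≤ (h<n (block⊆ {a} v∈))))) (≰⇒> nle))
          (<⇒≱ (s≤s (m≤m*n _ w {{>-nonZero 1≤w}})))

      class-bound : ∀ {a} → a < t → class a * w < n
      class-bound {a} a<t with filter (high? (class a)) (block a) in eq | class-high a<t
      ... | [] | le = contradiction (≤-trans 1≤s le) λ ()
      ... | v ∷ _ | _ with ∈-filter⁻ (high? (class a)) {xs = block a} (subst (v ∈_) (sym eq) (here refl))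
      ... | v∈ , le = ≤-<-trans le (h<n (block⊆ {a} v∈))

      -- The earlier block of a pair also lies before `a`, so `sees` has to leave out `bs`; `before`
      -- makes up for this by asking for disjoint lists of blocks.
      record Located (u : Unit) (a : ℕ) (bs : List ℕ) : Set where
        field
          within : ∀ {v} → v ∈ carrier u → ∃[ b ] (b ∈ bs × v ∈ block b)
          latest : ∀ {b} → b ∈ bs → b ≤ a
          sees   : ∀ {b v} → b < a → b ∉ bs → v ∈ block b → Sees v u

      before : ∀ {u u′ a a′ bs bs′} → Located u a bs → Located u′ a′ bs′ → a < a′ → Disjointₗ bs bs′ → Before u u′
      before {bs′ = bs′} l l′ a<a′ dis =
        (λ v∈ → let b , b∈ , v∈b = within l v∈ in
          sees l′ (≤-<-trans (latest l b∈) a<a′) (λ b∈′ → dis (b∈ , b∈′)) v∈b) ,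
        (λ (v∈ , v∈′) → let b , b∈ , v∈b = within l v∈ ; b′ , b′∈ , v∈b′ = within l′ v∈′ in
          dis (b∈ , subst (_∈ bs′) (sym (block-disjoint {b} {b′} v∈b v∈b′)) b′∈))
        where open Located

      collect : (items : List (ℕ × List ℕ)) →
        AllPairs Earlier items →
        All (λ (a , bs) → ∃[ u ] Located u a bs) items →
        ∃[ us ] (length us ≡ length items × AllPairs Before us × All (λ u → Any (λ (a , bs) → Located u a bs) items) us)
      collect [] _ _ = [] , refl , [] , []
      collect (i ∷ items) (r ∷ rs) ((u , l) ∷ ls) with collect items rs ls
      ... | us , len , bf , loc = u ∷ us , cong suc len ,
        All.map (λ any → let i′ , i′∈ , l′ = find any ; lt , dis = All.lookup r i′∈ in before l l′ lt dis) loc ∷ bf ,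
        here l ∷ All.map there loc

      -- All of `Y` precedes all of `X` in the order and is at most as high, whereas `pair` makes
      -- the earlier end of a blue edge strictly higher, whichever way the edge points.
      matchedUnit : ∀ {a b} → a < t → b < a → class a ≡ class b → s ≤ # (low? (class b)) (block b) →
                    ∃[ u ] Located u a (a ∷ b ∷ [])
      matchedUnit {a} {b} a<t b<a same many-low = pairUnit X Y uX uY dis free many-high many-low , record
        { within = λ v∈ → [ (λ v∈ → a , here refl , proj₁ (∈-X v∈)) , (λ v∈ → b , there (here refl) , proj₁ (∈-Y v∈)) ]′ (∈-++⁻ X v∈)
        ; latest = λ { (here refl) → ≤-refl ; (there (here refl)) → <⇒≤ b<a }
        ; sees = see }
        where
        j : ℕ
        j = class b
        X Y : List V
        X = filter (high? j) (block a)
        Y = filter (low? j) (block b)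
        uX : Unique X
        uX = Uniqueₚ.filter⁺ (high? j) (block-unique a)
        uY : Unique Y
        uY = Uniqueₚ.filter⁺ (low? j) (block-unique b)
        many-high : s ≤ length X
        many-high = subst (λ i → s ≤ # (high? i) (block a)) same (class-high a<t)
        ∈-X : ∀ {v} → v ∈ X → v ∈ block a × j * w ≤ h v
        ∈-X = ∈-filter⁻ (high? j) {xs = block a}
        ∈-Y : ∀ {v} → v ∈ Y → v ∈ block b × h v ≤ j * w
        ∈-Y = ∈-filter⁻ (low? j) {xs = block b}
        dis : Disjointₗ X Y
        dis (x∈ , y∈) = contradiction (block-disjoint {a} {b} (proj₁ (∈-X x∈)) (proj₁ (∈-Y y∈))) (>⇒≢ b<a)
        apart : ∀ {x y} → x ∈ X → y ∈ Y → ¬ (Bl y x ⊎ Bl x y)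
        apart x∈ y∈ e with ∈-X x∈ | ∈-Y y∈
        ... | xa , hx | yb , hy = contradiction (pair (block⊆ {b} yb) (block⊆ {a} xa) (block-order {b} {a} b<a yb xa) e)
          (≤⇒≯ (≤-trans hy hx))
        free : ∀ {x y} → x ∈ X → y ∈ Y → Free x y × Free y x
        free x∈ y∈ = apart x∈ y∈ ∘ inj₂ , apart x∈ y∈ ∘ inj₁
        some-Y : ∃[ y ] y ∈ Y
        some-Y = nonempty Y (≤-trans 1≤s many-low)
        see : ∀ {b′ v} → b′ < a → b′ ∉ a ∷ b ∷ [] → v ∈ block b′ →
              (∀ {x} → x ∈ X → Free v x) ⊎ (∀ {y} → y ∈ Y → Free v y)
        see {b′} {v} b′<a b′∉ v∈ with <-cmp b′ b
        ... | tri≈ _ eq _ = contradiction (there (here eq)) b′∉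
        -- Any `y` lies between `v` and `x`, so by `triple` a blue edge from `v` to `x` would make
        -- `x` lower than `y`.
        ... | tri< b′<b _ _ = inj₁ λ x∈ e →
          let xa , hx = ∈-X x∈ ; y , y∈ = some-Y ; yb , hy = ∈-Y y∈ in
          contradiction (triple (block⊆ {b′} v∈) (block⊆ {b} yb) (block⊆ {a} xa)
            (block-order {b′} {b} b′<b v∈ yb) (block-order {b} {a} b<a yb xa) e) (≤⇒≯ (≤-trans hy hx))
        -- Between the two blocks, the height of `v` decides: from `j * w` on, `pair` excludes edges
        -- to `Y`, and below it edges to `X`.
        ... | tri> _ _ b<b′ with high? j v
        ... | yes hv = inj₂ λ y∈ e → let yb , hy = ∈-Y y∈ in
          contradiction (pair (block⊆ {b} yb) (block⊆ {b′} v∈) (block-order {b} {b′} b<b′ yb v∈) (inj₂ e)) (≤⇒≯ (≤-trans hy hv))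
        ... | no hv = inj₁ λ x∈ e → let xa , hx = ∈-X x∈ in
          contradiction (pair (block⊆ {b′} v∈) (block⊆ {a} xa) (block-order {b′} {a} b′<a v∈ xa) (inj₁ e)) (≤⇒≯ (≤-trans (<⇒≤ (≰⇒> hv)) hx))

      -- Few vertices are outside the window of heights of the class. Once those with a blue edge
      -- from an earlier block are dropped, every earlier vertex sees the rest, and `pair` excludes
      -- blue edges between equal heights.
      flatUnit : ∀ {a} → a < t → # (low? (class a)) (block a) < s → ∃[ u ] Located u a (a ∷ [])
      flatUnit {a} a<t few-low = levelUnit h w (j * w) U uU range free wℓ big , record
        { within = λ v∈ → a , here refl , proj₁ (∈-U v∈)
        ; latest = λ { (here refl) → ≤-refl }
        ; sees = λ {b} b<a _ v∈ → inj₁ λ u∈ e → proj₂ (∈-filter⁻ (λ v → ¬? (early? v)) {xs = middle} u∈)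
            (lose (block⊆ {b} v∈) (<-≤-trans (block-upper {b} v∈) (*-monoˡ-≤ L b<a) , e)) }
        where
        j : ℕ
        j = class a
        middle? : ∀ v → Dec (j * w ≤ h v × h v < suc j * w)
        middle? v = (j * w ≤? h v) ×-dec (h v <? suc j * w)
        early? : ∀ v → Dec (Any (λ z → idx z < a * L × Bl z v) ord)
        early? v = Any.any? (λ z → (idx z <? a * L) ×-dec Bl? z v) ord
        middle U : List V
        middle = filter middle? (block a)
        U = filter (λ v → ¬? (early? v)) middle
        umiddle : Unique middle
        umiddle = Uniqueₚ.filter⁺ middle? (block-unique a)
        uU : Unique U
        uU = Uniqueₚ.filter⁺ _ umiddle
        ∈-middle : ∀ {v} → v ∈ middle → v ∈ block a × j * w ≤ h v × h v < suc j * w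
        ∈-middle = ∈-filter⁻ middle? {xs = block a}
        ∈-U : ∀ {v} → v ∈ U → v ∈ block a × j * w ≤ h v × h v < suc j * w
        ∈-U v∈ = ∈-middle (filter-⊆ _ v∈)
        range : All (λ v → j * w ≤ h v × h v < j * w + w) U
        range = All.tabulate λ v∈ → let _ , lo , hi = ∈-U v∈ in lo , <-≤-trans hi (≤-reflexive (+-comm w (j * w)))
        free : ∀ {u v} → u ∈ U → v ∈ U → u ≢ v → h u ≡ h v → Free u v
        free {u} {v} u∈ v∈ ne eq e with block⊆ {a} (proj₁ (∈-U u∈)) | block⊆ {a} (proj₁ (∈-U v∈)) | <-cmp (idx u) (idx v)
        ... | u∈o | v∈o | tri< lt _ _ = <-irrefl (sym eq) (pair u∈o v∈o lt (inj₁ e))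
        ... | u∈o | v∈o | tri≈ _ eqi _ = ne (index-injective u∈o v∈o eqi)
        ... | u∈o | v∈o | tri> _ _ gt = <-irrefl eq (pair v∈o u∈o gt (inj₂ e))
        -- By `triple`, an early vertex is lower than all earlier vertices of `middle`, so the early
        -- ones have different heights in a window of `w` values.
        few-early : # early? middle ≤ w
        few-early = subst₂ _≤_ (length-map h (filter early? middle)) (trans (length-map (j * w +_) (upTo w)) (length-upTo w))
          (unique-⊆-length (AllPairsₚ.map⁺ (AllPairs-map∈ distinct (Uniqueₚ.filter⁺ early? umiddle))) inWindow)
          where
          inWindow : map h (filter early? middle) ⊆ map (j * w +_) (upTo w)
          inWindow x∈ with ∈-map⁻ h x∈
          ... | v , v∈ , refl with ∈-middle (filter-⊆ early? v∈)
          ... | _ , lo , hi = subst (_∈ map (j * w +_) (upTo w)) (m+[n∸m]≡n lo)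
            (∈-map⁺ (j * w +_) (∈-upTo⁺ (+-cancelˡ-< (j * w) _ _
              (subst₂ _<_ (sym (m+[n∸m]≡n lo)) (+-comm w (j * w)) hi))))
          lower : ∀ {u v} → u ∈ filter early? middle → v ∈ filter early? middle → idx u < idx v → h v < h u
          lower {u} {v} u∈ v∈ lt with find (proj₂ (∈-filter⁻ early? {xs = middle} v∈))
          ... | z , z∈ , z< , e = triple z∈ (block⊆ {a} ua) (block⊆ {a} (proj₁ (∈-middle (filter-⊆ early? v∈))))
            (<-≤-trans z< (block-lower {a} ua)) lt e
            where ua = proj₁ (∈-middle (filter-⊆ early? u∈))
          distinct : ∀ {u v} → u ∈ filter early? middle → v ∈ filter early? middle → u ≢ v → h u ≢ h v
          distinct {u} {v} u∈ v∈ ne eq with <-cmp (idx u) (idx v)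
          ... | tri< lt _ _ = <-irrefl (sym eq) (lower u∈ v∈ lt)
          ... | tri≈ _ eqi _ = ne (index-injective (block⊆ {a} (proj₁ (∈-middle (filter-⊆ early? u∈)))) (block⊆ {a} (proj₁ (∈-middle (filter-⊆ early? v∈)))) eqi)
          ... | tri> _ _ gt = <-irrefl eq (lower v∈ u∈ gt)
        big : levelSize ≤ length U
        big = +-cancelˡ-≤ ((s + s) + w) levelSize _ (begin
          (s + s) + w + levelSize                 ≡⟨ +-assoc (s + s) w levelSize ⟩
          (s + s) + (w + levelSize)               ≤⟨ large ⟩
          L                                       ≡⟨ block-length a<t ⟨
          length (block a)                        ≤⟨ cover outer? middle? {block a} (λ {v} _ → classify v) ⟩
          # outer? (block a) + length middle      ≤⟨ +-mono-≤ few-outer (complement early? middle) ⟩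
          (s + s) + (# early? middle + length U)    ≤⟨ +-monoʳ-≤ (s + s) (+-monoˡ-≤ (length U) few-early) ⟩
          (s + s) + (w + length U)                ≡⟨ +-assoc (s + s) w _ ⟨
          (s + s) + w + length U                  ∎)
          where
          open ≤-Reasoning
          outer? : ∀ v → Dec (h v ≤ j * w ⊎ suc j * w ≤ h v)
          outer? v = low? j v ⊎-dec high? (suc j) v
          few-outer : # outer? (block a) ≤ s + s
          few-outer = ≤-trans (#-sub outer? (low? j) (high? (suc j)) (block a) id) (+-mono-≤ (<⇒≤ few-low) (<⇒≤ (class-next a)))
          classify : ∀ v → (h v ≤ j * w ⊎ suc j * w ≤ h v) ⊎ (j * w ≤ h v × h v < suc j * w)
          classify v with low? j v | high? (suc j) v
          ... | yes p | _ = inj₁ (inj₁ p)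
          ... | no _ | yes q = inj₁ (inj₂ q)
          ... | no p | no q = inj₂ (<⇒≤ (≰⇒> p) , ≰⇒> q)

      manyUnits : ∀ q Γ → (∀ {j} → j * w < n → j < Γ) → (q + q) + q + Γ ≤ t → ∃[ us ] (AllPairs Before us × q ≤ length us)
      manyUnits q Γ bound enough
        with select {λ a → s ≤ # (low? (class a)) (block a)} (λ a → s ≤? # (low? (class a)) (block a)) class q Γ t
          (bound ∘ class-bound) enough
      ... | items , sorted , kinds , le with collect items sorted (All.map locate kinds)
        where
        locate : ∀ {i} → Kind (λ a → s ≤ # (low? (class a)) (block a)) class t i → ∃[ u ] Located u (proj₁ i) (proj₂ i)
        locate (alone a<t high) = flatUnit a<t (≰⇒> high)
        locate (paired a<t b<a same low) = matchedUnit a<t b<a same low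
      ... | us , len , bf , _ = us , bf , subst (q ≤_) (sym len) le

  pathOrTree : {A : Set} {xs : List V} → Unique xs → (n ℓ w L t : ℕ) → ℓ ≤ k + k → 1 ≤ w → w * ℓ ≤ k + k →
    (pairSize + pairSize) + (w + levelSize) ≤ L →
    t * L ≤ length xs → (κ : Chunk A) → Short ℓ κ →
    (∀ {j} → j * w < n → j + ((cost κ + cost κ) + cost κ) < t) →
    Path Bl n ⊎ ∃[ x ] Embedding Rd κ x (λ _ → ⊤)
  pathOrTree _ zero _ _ _ _ _ _ _ _ _ _ _ _ = inj₁ ([] , refl , [] , [])
  pathOrTree {A} {xs = xs} uxs n@(suc n′) ℓ w L t ℓ≤2k 1≤w wℓ≤2k large fits κ short-κ few
    with DepthFirst.ordering Bl Bl? _≟_ xs uxs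
  ... | o with Any.any? (λ v → n′ ≤? DepthFirst.Ordering.h o v) (DepthFirst.Ordering.ord o)
  ... | yes long = inj₁ (reversePath (path (find long)))
    where
    open DepthFirst Bl Bl?
    open Ordering o
    path : ∃[ v ] (v ∈ ord × n′ ≤ h v) → Path (flip Bl) n
    path (v , v∈ , le) with paths v∈
    ... | q , len , link , u , inside with truncate q n′ (subst (n′ ≤_) (sym len) le) link u inside
    ... | q′ , len′ , link′ , u′ , _ = v ∷ q′ , len′ , link′ , u′
  -- The number of classes may be as large as `select` permits, which is t - 3q; the case j = 0 of
  -- `few` shows that 3q ≤ t.
  ... | no short = inj₂ (tree (manyUnits q (t ∸ ((q + q) + q)) (λ {j} lt → m+n≤o⇒m≤o∸n (suc j) (few {j} lt))
          (≤-reflexive (m+[n∸m]≡n (<⇒≤ (few {0} (s≤s z≤n)))))))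
    where
    open DepthFirst Bl Bl?
    open Ordering o
    open Units ℓ ℓ≤2k
    q : ℕ
    q = cost κ
    bound : ∀ {v} → v ∈ ord → h v < n
    bound v∈ = m≤n⇒m≤1+n (≰⇒> λ le → short (lose v∈ le))
    open Blocks uxs o n bound w 1≤w wℓ≤2k L t large fits
    pick : ∀ {us} → Placement.Placed κ us → ∃[ x ] Embedding Rd κ x (λ _ → ⊤)
    pick (target , _ , embeds) with Target.xl target | Target.kl target | embeds
    ... | [] | kl | _ = contradiction (≤-trans 1≤k kl) λ ()
    ... | x ∷ _ | _ | e ∷ _ = x , record
      { ψ = E.ψ ; keys = E.keys ; injective = E.injective ; inside = All.map (λ _ → tt) E.inside ; rooted = E.rooted ; arcs = E.arcs }
      where module E = Embedding e
    tree : ∃[ us ] (AllPairs Before us × q ≤ length us) → ∃[ x ] Embedding Rd κ x (λ _ → ⊤)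
    tree (us , bf , le) = pick (Placement.place κ us bf short-κ le)

-- Cutting a tree into paths

module _ {A : Set} where

  pieces : Chunk A → ℕ
  piecess : List (Chunk A) → ℕ
  pieces (chunk a as ks) = suc (piecess ks)
  piecess [] = 0
  piecess (κ ∷ ks) = pieces κ + piecess ks

  -- Each chunk accounts for one unit of its own and one for each child, and all chunks except the
  -- topmost are children.
  cost≡ : (κ : Chunk A) → suc (cost κ) ≡ 2 * pieces κ
  costs≡ : (ks : List (Chunk A)) → length ks + costs ks ≡ 2 * piecess ks
  cost≡ (chunk a as ks) = trans (cong (2 +_) (costs≡ ks)) (sym (*-suc 2 (piecess ks)))
  costs≡ [] = refl
  costs≡ (κ ∷ ks) = begin-equality
    suc (length ks) + (cost κ + costs ks)     ≡⟨ eq (length ks) (cost κ) (costs ks) ⟩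
    suc (cost κ) + (length ks + costs ks)     ≡⟨ cong₂ _+_ (cost≡ κ) (costs≡ ks) ⟩
    2 * pieces κ + 2 * piecess ks             ≡⟨ *-distribˡ-+ 2 (pieces κ) (piecess ks) ⟨
    2 * (pieces κ + piecess ks)               ∎
    where
    open ≤-Reasoning
    eq : ∀ a b c → suc a + (b + c) ≡ suc b + (a + c)
    eq = solve-∀

  top : Chunk A → ℕ
  top (chunk a as ks) = suc (length as)

  tips : A → Forest A → List A
  leavesOf : Forest A → List A
  tips w empty = w ∷ []
  tips w c@(node _ _ _) = leavesOf c
  leavesOf empty = []
  leavesOf (node w c s) = tips w c ++ leavesOf s

  module _ (ℓ : ℕ) (1≤ℓ : 1 ≤ ℓ) where

    graft : A → List (Chunk A) → Chunk A
    graft w [] = chunk w [] []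
    graft w ks@(_ ∷ _ ∷ _) = chunk w [] ks
    graft w ks@(chunk a as js ∷ []) with suc (length as) <? ℓ
    ... | yes _ = chunk w (a ∷ as) js
    ... | no _ = chunk w [] ks

    plants : Forest A → List (Chunk A)
    plants empty = []
    plants (node w c s) = graft w (plants c) ∷ plants s

    root-graft : ∀ w ks → root (graft w ks) ≡ w
    root-graft w [] = refl
    root-graft w (_ ∷ _ ∷ _) = refl
    root-graft w (chunk a as js ∷ []) with suc (length as) <? ℓ
    ... | yes _ = refl
    ... | no _ = refl

    labels-graft : ∀ w ks → labels (graft w ks) ≡ w ∷ labelss ks
    labels-graft w [] = refl
    labels-graft w (_ ∷ _ ∷ _) = refl
    labels-graft w (chunk a as js ∷ []) with suc (length as) <? ℓ
    ... | yes _ = cong (w ∷_) (sym (++-idʳ ((a ∷ as) ++ labelss js)))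
    ... | no _ = refl

    labels-plants : ∀ F → labelss (plants F) ↭ flat F
    labels-plants empty = ↭-refl
    labels-plants (node w c s) = ↭-trans (++⁺ʳ (labelss (plants s)) (↭-trans (↭-reflexive (labels-graft w (plants c))) (prep w (labels-plants c))))
      (↭-trans (prep w (++⁺ˡ (flat c) (labels-plants s))) (↭-sym (shift w (flat c) (flat s))))

    short-graft : ∀ w ks → Shorts ℓ ks → Short ℓ (graft w ks)
    short-graft w [] sh = 1≤ℓ , sh
    short-graft w (_ ∷ _ ∷ _) sh = 1≤ℓ , sh
    short-graft w (chunk a as js ∷ []) sh with suc (length as) <? ℓ
    ... | yes lt = lt , proj₂ (proj₁ sh)
    ... | no _ = 1≤ℓ , sh

    short-plants : ∀ F → Shorts ℓ (plants F)
    short-plants empty = tt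
    short-plants (node w c s) = short-graft w (plants c) (short-plants c) , short-plants s

    graft-root : ∀ {w ks κ} → κ ∈ ks → Arc (graft w ks) w (root κ)
    graft-root {w} {_ ∷ _ ∷ _} κ∈ = down κ∈
    graft-root {w} {chunk a as js ∷ []} κ∈ with suc (length as) <? ℓ
    graft-root {w} {chunk a as js ∷ []} (here refl) | yes _ = along first
    ... | no _ = down κ∈

    graft-arc : ∀ {w ks κ u v} → κ ∈ ks → Arc κ u v → Arc (graft w ks) u v
    graft-arc {w} {_ ∷ _ ∷ _} κ∈ arc = child κ∈ arc
    graft-arc {w} {chunk a as js ∷ []} κ∈ arc with suc (length as) <? ℓ
    ... | no _ = child κ∈ arc
    graft-arc {w} {chunk a as js ∷ []} (here refl) (along c) | yes _ = along (later c)
    graft-arc {w} {chunk a as js ∷ []} (here refl) (down κ∈) | yes _ = down κ∈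
    graft-arc {w} {chunk a as js ∷ []} (here refl) (child κ∈ arc) | yes _ = child κ∈ arc

    -- A chunk is closed early only at a leaf or at a branching, and there are fewer branchings than leaves.
    Economical : Chunk A → ℕ → Set
    Economical κ t = ℓ * pieces κ + top κ + ℓ ≤ length (labels κ) + 2 * (ℓ * t)

    data Economicals : List (Chunk A) → ℕ → Set where
      []  : Economicals [] 0
      _∷_ : ∀ {κ ks t t′} → Economical κ t → Economicals ks t′ → Economicals (κ ∷ ks) (t + t′)

    economical-sum : ∀ {ks t} → Economicals ks t → ℓ * piecess ks + length ks * ℓ ≤ length (labelss ks) + 2 * (ℓ * t)
    economical-sum [] = ≤-reflexive (trans (+-identityʳ _) (trans (*-zeroʳ ℓ) (sym (cong (2 *_) (*-zeroʳ ℓ)))))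
    economical-sum {κ ∷ ks} {.(t + t′)} (_∷_ {t = t} {t′} e es) = begin
      ℓ * (pieces κ + piecess ks) + (ℓ + length ks * ℓ)                      ≡⟨ eq ℓ (pieces κ) (piecess ks) (length ks * ℓ) ⟩
      (ℓ * pieces κ + ℓ) + (ℓ * piecess ks + length ks * ℓ)                  ≤⟨ +-mono-≤ (≤-trans (+-monoˡ-≤ ℓ (m≤m+n (ℓ * pieces κ) (top κ))) e) (economical-sum es) ⟩
      (length (labels κ) + 2 * (ℓ * t)) + (length (labelss ks) + 2 * (ℓ * t′)) ≡⟨ eq′ ℓ (length (labels κ)) (length (labelss ks)) t t′ ⟩
      (length (labels κ) + length (labelss ks)) + 2 * (ℓ * (t + t′))         ≡⟨ cong (_+ 2 * (ℓ * (t + t′))) (sym (length-++ (labels κ))) ⟩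
      length (labels κ ++ labelss ks) + 2 * (ℓ * (t + t′))                   ∎
      where
      open ≤-Reasoning
      eq : ∀ l p q b → l * (p + q) + (l + b) ≡ (l * p + l) + (l * q + b)
      eq = solve-∀
      eq′ : ∀ l a b t s → (a + 2 * (l * t)) + (b + 2 * (l * s)) ≡ (a + b) + 2 * (l * (t + s))
      eq′ = solve-∀

    economical-leaf : ∀ w → Economical (graft w []) 1
    economical-leaf w = ≤-reflexive (eq ℓ)
      where
      eq : ∀ l → l * 1 + 1 + l ≡ 1 + 2 * (l * 1)
      eq = solve-∀

    -- At a branching, the spare `ℓ` of two children pays for the new piece and its spare `ℓ`.
    -- Prolonging an only child's chunk adds one to both sides. If that chunk is full, its `top` is
    -- at least `ℓ` and pays for the new piece.
    economical-graft : ∀ w κ ks {t} → Economicals (κ ∷ ks) t → Economical (graft w (κ ∷ ks)) t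
    economical-graft w κ ks@(κ′ ∷ ks′) {t} es = begin
      ℓ * suc (piecess (κ ∷ ks)) + 1 + ℓ                     ≤⟨ m≤m+n _ _ ⟩
      ℓ * suc (piecess (κ ∷ ks)) + 1 + ℓ + length ks′ * ℓ    ≡⟨ eq ℓ (piecess (κ ∷ ks)) (length ks′ * ℓ) ⟩
      suc (ℓ * piecess (κ ∷ ks) + length (κ ∷ ks) * ℓ)       ≤⟨ s≤s (economical-sum es) ⟩
      suc (length (labelss (κ ∷ ks)) + 2 * (ℓ * t))          ∎
      where
      open ≤-Reasoning
      eq : ∀ l p b → l * suc p + 1 + l + b ≡ suc (l * p + (l + (l + b)))
      eq = solve-∀
    economical-graft w κ@(chunk a as js) [] {.(t + 0)} (_∷_ {t = t} e []) with suc (length as) <? ℓ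
    ... | yes _ = begin
      ℓ * suc (piecess js) + suc (suc (length as)) + ℓ       ≡⟨ cong (_+ ℓ) (+-suc _ _) ⟩
      suc (ℓ * suc (piecess js) + suc (length as) + ℓ)       ≤⟨ s≤s e ⟩
      suc (length (labels κ) + 2 * (ℓ * t))                  ≡⟨ cong (λ b → suc (length (labels κ) + 2 * (ℓ * b))) (sym (+-identityʳ t)) ⟩
      suc (length (labels κ) + 2 * (ℓ * (t + 0)))            ∎
      where open ≤-Reasoning
    ... | no full = begin
      ℓ * suc (suc (piecess js) + 0) + 1 + ℓ                 ≡⟨ eq ℓ (piecess js) ⟩
      suc (ℓ * suc (piecess js) + ℓ + ℓ)                     ≤⟨ s≤s (+-monoˡ-≤ ℓ (+-monoʳ-≤ (ℓ * suc (piecess js)) (≮⇒≥ full))) ⟩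
      suc (ℓ * suc (piecess js) + suc (length as) + ℓ)       ≤⟨ s≤s e ⟩
      suc (length (labels κ) + 2 * (ℓ * t))                  ≡⟨ cong₂ (λ xs b → suc (length xs + 2 * (ℓ * b))) (sym (++-idʳ (labels κ))) (sym (+-identityʳ t)) ⟩
      suc (length (labels κ ++ []) + 2 * (ℓ * (t + 0)))      ∎
      where
      open ≤-Reasoning
      eq : ∀ l p → l * suc (suc p + 0) + 1 + l ≡ suc (l * suc p + l + l)
      eq = solve-∀

    economical-tree : ∀ w c → Economical (graft w (plants c)) (length (tips w c))
    economical-forest : ∀ F → Economicals (plants F) (length (leavesOf F))
    economical-tree w empty = economical-leaf w
    economical-tree w c@(node _ _ _) = economical-graft w _ _ (economical-forest c)
    economical-forest empty = []
    economical-forest (node w c s) = subst (Economicals _) (sym (length-++ (tips w c))) (economical-tree w c ∷ economical-forest s)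

  -- Parent q F u v: u is the parent of v in the tree with root q and subtrees F.
  data Parent : A → Forest A → A → A → Set where
    direct : ∀ {q w c s} → Parent q (node w c s) q w
    below  : ∀ {q w c s u v} → Parent w c u v → Parent q (node w c s) u v
    aside  : ∀ {q w c s u v} → Parent q s u v → Parent q (node w c s) u v

  parent : ∀ {q F v} → v ∈ flat F → ∃[ u ] Parent q F u v
  parent {q} {node w c s} v∈ with ∈-++⁻ (flat c) v∈
  ... | inj₁ v∈c = let u , p = parent v∈c in u , below p
  ... | inj₂ (here refl) = q , direct
  ... | inj₂ (there v∈s) = let u , p = parent v∈s in u , aside p

  parent-source : ∀ {q F u v} → Parent q F u v → u ∈ q ∷ flat F
  parent-source direct = here refl
  parent-source {F = node w c s} (below p) with parent-source p
  ... | here refl = there (∈-++⁺ʳ (flat c) (here refl))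
  ... | there u∈ = there (∈-++⁺ˡ u∈)
  parent-source {F = node w c s} (aside p) with parent-source p
  ... | here refl = here refl
  ... | there u∈ = there (∈-++⁺ʳ (flat c) (there u∈))

  leaves⊆flat : ∀ F → leavesOf F ⊆ flat F
  tips⊆ : ∀ w c → tips w c ⊆ w ∷ flat c
  leaves⊆flat (node w c s) v∈ with ∈-++⁻ (tips w c) v∈
  ... | inj₂ v∈s = ∈-++⁺ʳ (flat c) (there (leaves⊆flat s v∈s))
  ... | inj₁ v∈t with tips⊆ w c v∈t
  ... | here refl = ∈-++⁺ʳ (flat c) (here refl)
  ... | there v∈c = ∈-++⁺ˡ v∈c
  tips⊆ w empty v∈ = v∈
  tips⊆ w c@(node _ _ _) v∈ = there (leaves⊆flat c v∈)

  leaves-unique : ∀ F → Unique (flat F) → Unique (leavesOf F)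
  tips-unique : ∀ w c → Unique (flat c) → Unique (tips w c)
  leaves-unique empty _ = []
  leaves-unique (node w c s) u with AllPairs-++⁻ (flat c) u
  ... | uc , (w∉ ∷ us) , cross = Uniqueₚ.++⁺ (tips-unique w c uc) (leaves-unique s us) dis
    where
    dis : Disjointₗ (tips w c) (leavesOf s)
    dis (v∈ , v∈s) with tips⊆ w c v∈
    ... | here refl = All.lookup w∉ (leaves⊆flat s v∈s) refl
    ... | there v∈c = All.lookup (All.lookup cross v∈c) (there (leaves⊆flat s v∈s)) refl
  tips-unique w empty _ = [] ∷ []
  tips-unique w c@(node _ _ _) u = leaves-unique c u

  leaf-childless : ∀ {q F u v} → Unique (q ∷ flat F) → Parent q F u v → u ∉ leavesOf F
  leaf-childless {F = F} (q∉ ∷ _) direct u∈ = All.lookup q∉ (leaves⊆flat F u∈) refl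
  leaf-childless {F = node w c s} (q∉ ∷ uF) p u∈ with AllPairs-++⁻ (flat c) uF | ∈-++⁻ (tips w c) u∈ | p
  ... | _ | _ | direct = All.lookup q∉ (leaves⊆flat (node w c s) u∈) refl
  ... | uc , (w∉ ∷ us) , cross | inj₂ u∈s | below p′ with parent-source p′
  ... | here refl = All.lookup w∉ (leaves⊆flat s u∈s) refl
  ... | there u∈c = All.lookup (All.lookup cross u∈c) (there (leaves⊆flat s u∈s)) refl
  leaf-childless {F = node w c s} (q∉ ∷ uF) p u∈ | uc , (w∉ ∷ us) , cross | inj₁ u∈t | aside p′ with parent-source p′ | tips⊆ w c u∈t
  ... | here refl | here refl = All.lookup q∉ (∈-++⁺ʳ (flat c) (here refl)) refl
  ... | here refl | there u∈c = All.lookup q∉ (∈-++⁺ˡ u∈c) refl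
  ... | there u∈s | here refl = All.lookup w∉ u∈s refl
  ... | there u∈s | there u∈c = All.lookup (All.lookup cross u∈c) (there u∈s) refl
  leaf-childless {F = node w c s} (q∉ ∷ uF) p u∈ | uc , (w∉ ∷ us) , cross | inj₂ u∈s | aside p′ =
    leaf-childless (All.tail (Allₚ.++⁻ʳ (flat c) q∉) ∷ us) p′ u∈s
  leaf-childless {F = node w c@(node _ _ _) s} (q∉ ∷ uF) p u∈ | uc , (w∉ ∷ us) , cross | inj₁ u∈t | below p′ =
    leaf-childless (All.tabulate (λ v∈ eq → All.head (All.lookup cross v∈) (sym eq)) ∷ uc) p′ u∈t

  parent-arc : ∀ ℓ 1≤ℓ {q F u v} → Parent q F u v → Arc (graft ℓ 1≤ℓ q (plants ℓ 1≤ℓ F)) u v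
  parent-arc ℓ 1≤ℓ p with split p
    where
    split : ∀ {q F u v} → Parent q F u v →
            (u ≡ q × ∃[ κ ] (κ ∈ plants ℓ 1≤ℓ F × root κ ≡ v)) ⊎ (∃[ κ ] (κ ∈ plants ℓ 1≤ℓ F × Arc κ u v))
    split {F = node w c s} direct = inj₁ (refl , _ , here refl , root-graft ℓ 1≤ℓ w (plants ℓ 1≤ℓ c))
    split {F = node w c s} (below p) = inj₂ (_ , here refl , parent-arc ℓ 1≤ℓ p)
    split {F = node w c s} (aside p) with split p
    ... | inj₁ (eq , κ , κ∈ , r) = inj₁ (eq , κ , there κ∈ , r)
    ... | inj₂ (κ , κ∈ , arc) = inj₂ (κ , there κ∈ , arc)
  ... | inj₁ (refl , κ , κ∈ , refl) = graft-root ℓ 1≤ℓ κ∈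
  ... | inj₂ (κ , κ∈ , arc) = graft-arc ℓ 1≤ℓ κ∈ arc

-- The search tree of a directed tree

module Rooted {A : Set} (_≟_ : DecidableEquality A) (E : A → A → Set) (E? : Decidable₂ E)
  (xs : List A) (uxs : Unique xs) (all : ∀ v → v ∈ xs) (r : A)
  (no-arc-to-root : ∀ {u} → ¬ E u r) (unique-parent : ∀ {u u′ v} → E u v → E u′ v → u ≡ u′)
  (reachable : (P : A → Set) → P r → (∀ {u v} → P u → E u v → P v) → ∀ v → P v) where

  open DepthFirst E E?

  others : List A
  others = filter (λ v → ¬? (r ≟ v)) xs

  record Spanning : Set where
    field
      F : Forest A
      found : Search (E r) F
      covers : ∀ v → v ∈ r ∷ flat F
      unique : Unique (r ∷ flat F)

  -- No edge leads from `r` or a visited vertex to `rest`, so the visited vertices together with `r`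
  -- are closed under `E` and thus contain everything.
  spanning : Spanning
  spanning with search (E r) (E? r) (length others) others ≤-refl
  ... | F , rest , found , perm , none , edges = record { F = F ; found = found
    ; covers = reachable (_∈ r ∷ flat F) (here refl) step
    ; unique = All.tabulate (λ v∈ → proj₂ (∈-filter⁻ (λ v → ¬? (r ≟ v)) {xs = xs} (∈-resp-↭ (↭-sym perm) (∈-++⁺ˡ v∈)))) ∷
        proj₁ (AllPairs-++⁻ (flat F) (unique-resp-↭ perm (Uniqueₚ.filter⁺ _ uxs))) }
    where
    step : ∀ {u v} → u ∈ r ∷ flat F → E u v → v ∈ r ∷ flat F
    step {u} {v} u∈ e with r ≟ v
    ... | yes refl = here refl
    ... | no ne with ∈-++⁻ (flat F) (∈-resp-↭ perm (∈-filter⁺ (λ v → ¬? (r ≟ v)) (all v) ne)) | u∈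
    ... | inj₁ v∈F | _ = there v∈F
    ... | inj₂ v∈rest | here refl = contradiction e (All.lookup none v∈rest)
    ... | inj₂ v∈rest | there u∈F = contradiction e (All.lookup (All.lookup edges u∈F) v∈rest)

  open Spanning spanning public

  search-parent : ∀ {q G u v} → Search (E q) G → Parent q G u v → E u v
  search-parent (node e _ _ _) direct = e
  search-parent (node _ sc _ _) (below p) = search-parent sc p
  search-parent (node _ _ ss _) (aside p) = search-parent ss p

  -- The search gives `v` some parent, joined to `v` by an arc, and `unique-parent` identifies it
  -- with `u`.
  arc-parent : ∀ {u v} → E u v → Parent r F u v
  arc-parent {u} {v} e with covers v
  ... | here refl = contradiction e no-arc-to-root
  ... | there v∈ with parent v∈
  ... | u′ , p with unique-parent e (search-parent found p)
  ... | refl = p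

  record Spans (κ : Chunk A) : Set where
    field
      everywhere : ∀ v → v ∈ labels κ
      distinct : Unique (labels κ)
      arcs : ∀ {u v} → E u v → Arc κ u v

  chunks : ∀ ℓ → 1 ≤ ℓ → ∃[ κ ] (Spans κ × Short ℓ κ × ℓ * cost κ ≤ 2 * (length xs + 2 * (ℓ * length (tips r F))))
  chunks ℓ 1≤ℓ = κ , record
    { everywhere = λ v → ∈-resp-↭ (↭-sym perm) (covers v)
    ; distinct = unique-resp-↭ (↭-sym perm) unique
    ; arcs = λ e → parent-arc ℓ 1≤ℓ (arc-parent e) } ,
    short-graft ℓ 1≤ℓ r _ (short-plants ℓ 1≤ℓ F) , cheap
    where
    κ : Chunk A
    κ = graft ℓ 1≤ℓ r (plants ℓ 1≤ℓ F)
    perm : labels κ ↭ r ∷ flat F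
    perm = ↭-trans (↭-reflexive (labels-graft ℓ 1≤ℓ r (plants ℓ 1≤ℓ F))) (prep r (labels-plants ℓ 1≤ℓ F))
    T : ℕ
    T = length (tips r F)
    cheap : ℓ * cost κ ≤ 2 * (length xs + 2 * (ℓ * T))
    cheap = begin
      ℓ * cost κ                                    ≤⟨ *-monoʳ-≤ ℓ (≤-trans (n≤1+n _) (≤-reflexive (cost≡ κ))) ⟩
      ℓ * (2 * pieces κ)                            ≡⟨ eq ℓ (pieces κ) ⟩
      2 * (ℓ * pieces κ)                            ≤⟨ *-monoʳ-≤ 2 (≤-trans (≤-trans (m≤m+n _ (top κ)) (m≤m+n _ ℓ)) (economical-tree ℓ 1≤ℓ r F)) ⟩
      2 * (length (labels κ) + 2 * (ℓ * T))         ≤⟨ *-monoʳ-≤ 2 (+-monoˡ-≤ (2 * (ℓ * T)) (unique-⊆-length (unique-resp-↭ (↭-sym perm) unique) (λ {v} _ → all v))) ⟩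
      2 * (length xs + 2 * (ℓ * T))                 ∎
      where
      open ≤-Reasoning
      eq : ∀ l p → l * (2 * p) ≡ 2 * (l * p)
      eq = solve-∀

  leaf-no-arc : ∀ {v} → v ∈ leavesOf F → ∀ {u} → ¬ E v u
  leaf-no-arc v∈ e = leaf-childless unique (arc-parent e) v∈

-- Simple paths and uniqueness of parents

module SimplePaths {A : Set} (_≟_ : DecidableEquality A) where

  Simple : (A → A → Set) → (A → Set) → A → A → Set
  Simple R P u v = ∃[ q ] (Linked R (u ∷ q) × Unique (u ∷ q) × final u q ≡ v × All P (u ∷ q))

  suffix : ∀ {R P u w q} → Linked R (w ∷ q) → Unique (w ∷ q) → All P (w ∷ q) → u ∈ w ∷ q → Simple R P u (final w q)
  suffix {q = q} link uq a (here refl) = q , link , uq , refl , a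
  suffix {q = x ∷ q} (_ ∷ link) (_ ∷ uq) (_ ∷ a) (there u∈) = suffix link uq a u∈

  -- If `u` already occurs on the path, the part before it is cut off.
  extend : ∀ {R P u w v} → R u w → P u → Simple R P w v → Simple R P u v
  extend {u = u} {w} e pu (q , link , uq , refl , a) with Any.any? (u ≟_) (w ∷ q)
  ... | yes u∈ = suffix link uq a u∈
  ... | no u∉ = w ∷ q , e ∷ link , Allₚ.¬Any⇒All¬ (w ∷ q) u∉ ∷ uq , refl , pu ∷ a

  backwards : ∀ {R S P u v z} → (∀ {x y} → R x y → S y x) → Simple R P u v → Simple S P u z → Simple S P v z
  backwards {R} {S} {P} {z = z} flip-edge (q , link , _ , refl , a) = go _ q link a
    where
    go : ∀ u q → Linked R (u ∷ q) → All P (u ∷ q) → Simple S P u z → Simple S P (final u q) z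
    go u [] _ _ acc = acc
    go u (x ∷ q) (e ∷ link) (_ ∷ a) acc = go x q link a (extend (flip-edge e) (All.head a) acc)

  map-simple : ∀ {R S P u v} → (∀ {x y} → R x y → S x y) → Simple R P u v → Simple S P u v
  map-simple f (q , link , rest) = q , Linked.map f link , rest

  -- In a digraph whose underlying graph has no cycle and in which r reaches everything, a second
  -- arc into v would close a cycle with the two paths from r.
  module Acyclic (E : A → A → Set) (irreflexive : ∀ {u} → ¬ E u u) (asymmetric : ∀ {u v} → E u v → ¬ E v u)
    (acyclic : ∀ {u x y q} → Linked (λ a b → E a b ⊎ E b a) (u ∷ x ∷ y ∷ q) → Unique (u ∷ x ∷ y ∷ q) →
               ¬ (E (final y q) u ⊎ E u (final y q)))
    (r : A) (path : ∀ v → Simple E (λ _ → ⊤) r v) where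

    private
      U : A → A → Set
      U a b = E a b ⊎ E b a

    no-return : ∀ {u v} → Simple E (λ _ → ⊤) v u → ¬ E u v
    no-return ([] , _ , _ , refl , _) e = irreflexive e
    no-return (x ∷ [] , e′ ∷ _ , _ , refl , _) e = asymmetric e′ e
    no-return (x ∷ y ∷ q , link , uq , refl , _) e = acyclic (Linked.map inj₁ link) uq (inj₁ e)

    no-arc-to-root : ∀ {u} → ¬ E u r
    no-arc-to-root {u} = no-return (path u)

    -- If the path from `r` to `u` met `v`, its part from `v` on would close a directed cycle with
    -- the arc from `u` to `v`.
    avoiding : ∀ {u v} → E u v → Simple E (_≢ v) r u
    avoiding {u} {v} e with path u
    ... | q , link , uq , refl , a with Any.any? (v ≟_) (r ∷ q)
    ... | yes v∈ = contradiction e (no-return (suffix link uq a v∈))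
    ... | no v∉ = q , link , uq , refl , All.map (λ ne eq → ne (sym eq)) (Allₚ.¬Any⇒All¬ (r ∷ q) v∉)

    unique-parent : ∀ {u u′ v} → E u v → E u′ v → u ≡ u′
    unique-parent {u} {u′} {v} e e′ with backwards {S = U} inj₂ (avoiding e) (map-simple inj₁ (avoiding e′))
    ... | [] , _ , _ , eq , _ = eq
    ... | x ∷ q , link , uq , refl , a = contradiction (inj₁ e′)
      (acyclic (inj₂ e ∷ link) (All.map (λ ne eq → ne (sym eq)) a ∷ uq))

-- Counting and sizes

trues : ∀ {n} → (Fin n → Bool) → List (Fin n)
trues {zero} p = []
trues {suc n} p = (if p zero then zero ∷ [] else []) ++ map suc (trues (p ∘ suc))

length-trues : ∀ {n} (p : Fin n → Bool) → length (trues p) ≡ countB p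
length-trues {zero} p = refl
length-trues {suc n} p with p zero
... | true = cong suc (trans (length-map suc (trues (p ∘ suc))) (length-trues (p ∘ suc)))
... | false = trans (length-map suc (trues (p ∘ suc))) (length-trues (p ∘ suc))

∈-trues : ∀ {n} (p : Fin n → Bool) {i} → p i ≡ true → i ∈ trues p
∈-trues p {zero} eq rewrite eq = here refl
∈-trues p {suc i} eq = ∈-++⁺ʳ (if p zero then zero ∷ [] else []) (∈-map⁺ suc (∈-trues (p ∘ suc) eq))

unique-countB : ∀ {n} (p : Fin n → Bool) {xs} → Unique xs → (∀ {i} → i ∈ xs → p i ≡ true) → length xs ≤ countB p
unique-countB p u f = subst (_ ≤_) (length-trues p) (unique-⊆-length u (∈-trues p ∘ f))

trues-true : ∀ {n} (p : Fin n → Bool) {i} → i ∈ trues p → p i ≡ true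
trues-true {suc n} p i∈ with p zero in eq
trues-true {suc n} p (here refl) | true = eq
trues-true {suc n} p (there i∈) | true with ∈-map⁻ suc i∈
... | j , j∈ , refl = trues-true (p ∘ suc) j∈
trues-true {suc n} p i∈ | false with ∈-map⁻ suc i∈
... | j , j∈ , refl = trues-true (p ∘ suc) j∈

trues-unique : ∀ {n} (p : Fin n → Bool) → Unique (trues p)
trues-unique {zero} p = []
trues-unique {suc n} p with p zero
... | true = All.tabulate (λ i∈ → λ { refl → case ∈-map⁻ suc i∈ of λ { (_ , _ , ()) } }) ∷ Uniqueₚ.map⁺ Finₚ.suc-injective (trues-unique (p ∘ suc))
... | false = Uniqueₚ.map⁺ Finₚ.suc-injective (trues-unique (p ∘ suc))

countB-one : ∀ {n} (p : Fin n → Bool) {i} → p i ≡ true → (∀ {j} → p j ≡ true → j ≡ i) → countB p ≡ 1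
countB-one p {i} pi only = ≤-antisym
  (subst (_≤ 1) (length-trues p) (unique-⊆-length {ys = i ∷ []} (trues-unique p) λ j∈ → here (only (trues-true p j∈))))
  (unique-countB p {i ∷ []} ([] ∷ []) λ { (here refl) → pi })

countB-positive : ∀ {n} (p : Fin n → Bool) → 1 ≤ countB p → ∃[ i ] p i ≡ true
countB-positive p le with trues p in eq
... | [] = contradiction (subst (1 ≤_) (sym (trans (sym (cong length eq)) (length-trues p))) le) λ ()
... | i ∷ _ = i , trues-true p (subst (i ∈_) (sym eq) (here refl))

rowSum : ∀ {k} → (Fin k → ℕ) → ℕ
rowSum {zero} f = 0
rowSum {suc k} f = f zero + rowSum (f ∘ suc)

-- The summation inside eDir is local to it and cannot be named; generalising the goal over the row
-- counts and over the digraph lets Agda infer it as the left-hand side of local-sum.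
mutual
  local-sum : ∀ {M} (G : Digraph M) (A B : Fin M → Bool) (k : ℕ) (f : Fin k → ℕ) → _ ≡ rowSum f

  eDir-rowSum : ∀ {N} (G : Digraph N) (A B : Fin N → Bool) → eDir G A B ≡ rowSum (λ a → countB (λ b → A a ∧ (B b ∧ G a b)))
  eDir-rowSum {zero} G A B = refl
  eDir-rowSum {suc N} G A B
    with (if A zero ∧ (B zero ∧ G zero zero) then 1 else 0) + countB (λ j → A zero ∧ (B (suc j) ∧ G zero (suc j)))
    | (λ (i : Fin N) → (if A (suc i) ∧ (B zero ∧ G (suc i) zero) then 1 else 0) + countB (λ j → A (suc i) ∧ (B (suc j) ∧ G (suc i) (suc j))))
  ... | row | rows with suc N | G | A | B
  ... | M | G′ | A′ | B′ = cong (row +_) (local-sum G′ A′ B′ N rows)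

  local-sum G A B zero f = refl
  local-sum G A B (suc k) f = cong (f zero +_) (local-sum G A B k (f ∘ suc))

rowSum-positive : ∀ {k} (f : Fin k → ℕ) → 1 ≤ rowSum f → ∃[ i ] 1 ≤ f i
rowSum-positive {suc k} f le with f zero in eq
... | suc x = zero , subst (1 ≤_) (sym eq) (s≤s z≤n)
... | zero with rowSum-positive (f ∘ suc) le
... | i , p = suc i , p

∧-true : ∀ {x y} → x ∧ y ≡ true → x ≡ true × y ≡ true
∧-true {true} {true} _ = refl , refl

eDir-edge : ∀ {N} (G : Digraph N) (A B : Fin N → Bool) → 1 ≤ eDir G A B → ∃[ a ] ∃[ b ] (A a ≡ true × B b ≡ true × G a b ≡ true)
eDir-edge G A B le with rowSum-positive _ (subst (1 ≤_) (eDir-rowSum G A B) le)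
... | a , row with countB-positive (λ b → A a ∧ (B b ∧ G a b)) row
... | b , eq with ∧-true {A a} eq
... | pa , eq′ with ∧-true {B b} eq′
... | pb , g = a , b , pa , pb , g

-- Logarithms and numerical estimates

log₂ : ∀ N → 1 ≤ N → ∃[ e ] (2 ^ e ≤ N × N < 2 ^ suc e)
log₂ (suc zero) _ = 0 , ≤-refl , s≤s (s≤s z≤n)
log₂ (suc (suc N)) _ with log₂ (suc N) (s≤s z≤n)
... | e , lo , hi with suc (suc N) <? 2 ^ suc e
... | yes lt = e , m≤n⇒m≤1+n lo , lt
... | no nlt = suc e , ≮⇒≥ nlt , <-≤-trans (s≤s hi) (+-mono-≤ {1} (m^n>0 2 (suc e)) (≤-reflexive (sym (+-identityʳ (2 ^ suc e)))))

x<2^x : ∀ x → x < 2 ^ x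
x<2^x zero = s≤s z≤n
x<2^x (suc x) = +-mono-≤ (m^n>0 2 x) (≤-trans (x<2^x x) (≤-reflexive (sym (+-identityʳ (2 ^ x)))))

2^-cancel-≤ : ∀ {a b} → 2 ^ a ≤ 2 ^ b → a ≤ b
2^-cancel-≤ {a} {b} le = ≮⇒≥ λ lt → <⇒≱ (^-monoʳ-< 2 (s≤s (s≤s z≤n)) lt) le

-- With `d` the integer part of e/4, both 4P ≤ d + 1 and e + 1 ≤ 4(d + 1), so P(e + 1) is at most (d
-- + 1)², and d + 1 ≤ 2^d.
square-below : ∀ P e → 16 * P ≤ e → (P * suc e) * (P * suc e) ≤ 2 ^ e
square-below P e le = begin
  (P * suc e) * (P * suc e)                   ≤⟨ *-mono-≤ small small ⟩
  (suc d * suc d) * (suc d * suc d)           ≤⟨ *-mono-≤ (*-mono-≤ (x<2^x d) (x<2^x d)) (*-mono-≤ (x<2^x d) (x<2^x d)) ⟩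
  (2 ^ d * 2 ^ d) * (2 ^ d * 2 ^ d)           ≡⟨ cong₂ _*_ (sym (^-distribˡ-+-* 2 d d)) (sym (^-distribˡ-+-* 2 d d)) ⟩
  2 ^ (d + d) * 2 ^ (d + d)                   ≡⟨ ^-distribˡ-+-* 2 (d + d) (d + d) ⟨
  2 ^ ((d + d) + (d + d))                     ≤⟨ ^-monoʳ-≤ 2 (≤-trans (≤-reflexive (eq d)) (m/n*n≤m e 4)) ⟩
  2 ^ e                                       ∎
  where
  open ≤-Reasoning
  d : ℕ
  d = e / 4
  eq : ∀ d → (d + d) + (d + d) ≡ d * 4
  eq = solve-∀
  e<4d+4 : suc e ≤ 4 * suc d
  e<4d+4 = begin
    suc e                   ≡⟨ cong suc (m≡m%n+[m/n]*n e 4) ⟩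
    suc (e % 4 + d * 4)     ≤⟨ +-monoˡ-≤ (d * 4) (m%n<n e 4) ⟩
    suc d * 4               ≡⟨ *-comm (suc d) 4 ⟩
    4 * suc d               ∎
  4P≤ : P * 4 ≤ suc d
  4P≤ = *-cancelˡ-≤ 4 (≤-trans (≤-reflexive (eq′ P)) (≤-trans (≤-trans le (n≤1+n e)) e<4d+4))
    where
    eq′ : ∀ P → 4 * (P * 4) ≡ 16 * P
    eq′ = solve-∀
  small : P * suc e ≤ suc d * suc d
  small = begin
    P * suc e               ≤⟨ *-monoʳ-≤ P e<4d+4 ⟩
    P * (4 * suc d)         ≡⟨ *-assoc P 4 (suc d) ⟨
    P * 4 * suc d           ≤⟨ *-monoˡ-≤ (suc d) 4P≤ ⟩
    suc d * suc d           ∎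

-- The smaller factor is replaced by the larger one: if this is P(e + 1), `square-below` applies;
-- otherwise λ′ ≥ P(e + 1), and the product is at most λ′³, hence at most λ′⁶.
leaf-bound : ∀ P e N λ′ → 1 ≤ P → 16 * P ≤ e → 2 ^ e ≤ N → λ′ ^ 6 ≤ N → (P * suc e) * suc λ′ ≤ N
leaf-bound P e N λ′ 1≤P le lo pow with suc λ′ ≤? P * suc e
... | yes small = ≤-trans (*-monoʳ-≤ (P * suc e) small) (≤-trans (square-below P e le) lo)
... | no large = begin
  (P * suc e) * suc λ′          ≤⟨ *-mono-≤ M≤λ suc-bound ⟩
  λ′ * (λ′ * λ′)                ≤⟨ m≤m*n _ (λ′ * (λ′ * λ′)) {{>-nonZero (*-mono-≤ 1≤λ (*-mono-≤ 1≤λ 1≤λ))}} ⟩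
  λ′ * (λ′ * λ′) * (λ′ * (λ′ * λ′)) ≡⟨ eq λ′ ⟩
  λ′ ^ 6                        ≤⟨ pow ⟩
  N                             ∎
  where
  open ≤-Reasoning
  M≤λ : P * suc e ≤ λ′
  M≤λ = s≤s⁻¹ (≰⇒> large)
  2≤λ : 2 ≤ λ′
  2≤λ = ≤-trans (≤-trans (*-mono-≤ 1≤P (s≤s (≤-trans (≤-trans 1≤P (m≤n*m P 16)) le))) ≤-refl) M≤λ
  1≤λ : 1 ≤ λ′
  1≤λ = ≤-trans (n≤1+n 1) 2≤λ
  suc-bound : suc λ′ ≤ λ′ * λ′
  suc-bound = ≤-trans (≤-trans (+-monoˡ-≤ λ′ 1≤λ) (≤-reflexive (cong (λ′ +_) (sym (+-identityʳ λ′))))) (*-monoˡ-≤ λ′ 2≤λ)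
  eq : ∀ x → x * (x * x) * (x * (x * x)) ≡ x * (x * (x * (x * (x * (x * 1)))))
  eq = solve-∀

lookup-injective : {A : Set} {xs : List A} → Unique xs → ∀ i j → lookup xs i ≡ lookup xs j → i ≡ j
lookup-injective {xs = x ∷ xs} (x∉ ∷ u) zero zero eq = refl
lookup-injective {xs = x ∷ xs} (x∉ ∷ u) zero (suc j) eq = contradiction eq (All.lookup x∉ (∈-lookup j))
lookup-injective {xs = x ∷ xs} (x∉ ∷ u) (suc i) zero eq = contradiction (sym eq) (All.lookup x∉ (∈-lookup i))
lookup-injective {xs = x ∷ xs} (x∉ ∷ u) (suc i) (suc j) eq = cong suc (lookup-injective u i j eq)

lookup-linked : {A : Set} {R : A → A → Set} {xs : List A} → Linked R xs → ∀ i j → toℕ j ≡ suc (toℕ i) → R (lookup xs i) (lookup xs j)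
lookup-linked (e ∷ link) zero (suc zero) eq = e
lookup-linked (e ∷ link) (suc i) (suc j) eq = lookup-linked link i j (suc-injective eq)

lookup-final : {A : Set} (x : A) (xs : List A) → ∀ i → toℕ i ≡ length xs → lookup (x ∷ xs) i ≡ final x xs
lookup-final x [] zero eq = refl
lookup-final x (y ∷ xs) (suc i) eq = lookup-final y xs i (suc-injective eq)

true? : (b : Bool) → Dec (b ≡ true)
true? b = b Bool.≟ true

-- Directed trees as digraphs on `Fin m`

module Tree {m : ℕ} (T : Digraph m) (oriented : IsOriented T) (no-cycle : ¬ HasCycle T) where

  arc : Fin m → Fin m → Set
  arc u v = T u v ≡ true

  arc-irreflexive : ∀ {u} → ¬ arc u u
  arc-irreflexive {u} e = case trans (sym e) (proj₁ oriented u) of λ ()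

  arc-asymmetric : ∀ {u v} → arc u v → ¬ arc v u
  arc-asymmetric {u} {v} e e′ = case trans (sym (cong₂ _∧_ e e′)) (proj₂ oriented u v) of λ ()

  und : ∀ {u v} → arc u v ⊎ arc v u → Und T u v ≡ true
  und {u} {v} (inj₁ e) rewrite e = refl
  und {u} {v} (inj₂ e) rewrite e with T u v
  ... | true = refl
  ... | false = refl

  und⁻ : ∀ {u v} → Und T u v ≡ true → arc u v ⊎ arc v u
  und⁻ {u} {v} e with T u v
  ... | true = inj₁ refl
  ... | false = inj₂ e

  acyclic : ∀ {u x y q} → Linked (λ a b → Und T a b ≡ true) (u ∷ x ∷ y ∷ q) → Unique (u ∷ x ∷ y ∷ q) → ¬ (Und T (final y q) u ≡ true)
  acyclic {u} {x} {y} {q} link uq closing = no-cycle (length q , lookup (u ∷ x ∷ y ∷ q) , lookup-injective uq _ _ , edges)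
    where
    edges : (i j : Fin (suc (suc (suc (length q))))) → (toℕ j ≡ suc (toℕ i) ⊎ (toℕ i ≡ suc (suc (length q)) × toℕ j ≡ 0)) →
            Und T (lookup (u ∷ x ∷ y ∷ q) i) (lookup (u ∷ x ∷ y ∷ q) j) ≡ true
    edges i j (inj₁ eq) = lookup-linked link i j eq
    edges i zero (inj₂ (eq , _)) = subst (λ z → Und T z u ≡ true) (sym (lookup-final u (x ∷ y ∷ q) i eq)) closing

  open SimplePaths (Fin._≟_ {m})

  walk-simple : ∀ {u v} → DWalk T u v → Simple arc (λ _ → ⊤) u v
  walk-simple (here u) = [] , [-] , ([] ∷ []) , refl , (tt ∷ [])
  walk-simple (there e walk) = extend e tt (walk-simple walk)

  -- E is the arc relation of T or its converse, so that it leads away from the root r.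
  module Directed (E : Fin m → Fin m → Set) (E? : Decidable₂ E) (E-arc : ∀ {u v} → E u v → arc u v ⊎ arc v u)
    (arc-E : ∀ {u v} → arc u v ⊎ arc v u → E u v ⊎ E v u)
    (irreflexive : ∀ {u} → ¬ E u u) (asymmetric : ∀ {u v} → E u v → ¬ E v u)
    (r : Fin m) (path : ∀ v → Simple E (λ _ → ⊤) r v) where

    E-und : ∀ {u v} → E u v ⊎ E v u → Und T u v ≡ true
    E-und = und ∘ [ E-arc , Sum.swap ∘ E-arc ]′

    open Acyclic E irreflexive asymmetric
      (λ link uq closing → acyclic (Linked.map E-und link) uq (E-und closing)) r path

    reachable : (P : Fin m → Set) → P r → (∀ {u v} → P u → E u v → P v) → ∀ v → P v
    reachable P base step v with path v
    ... | q , link , _ , refl , _ = go r q link base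
      where
      go : ∀ u q → Linked E (u ∷ q) → P u → P (final u q)
      go u [] _ p = p
      go u (x ∷ q) (e ∷ link) p = go x q link (step p e)

    open Rooted Fin._≟_ E E? (allFin m) (Uniqueₚ.allFin⁺ m) ∈-allFin r no-arc-to-root unique-parent reachable public

    -- A childless vertex other than `r` has its parent as only neighbour, so it has degree one. The
    -- added 1 is for the tree with one vertex, where `r` is a tip of degree zero.
    few-tips : length (tips r F) ≤ suc (leaves T)
    few-tips with F | leaves-unique F (AllPairs.tail unique) | leaf-degree
      where
      leaf-degree : ∀ {v} → v ∈ leavesOf F → isOne (degree T v) ≡ true
      leaf-degree {v} v∈ with parent {q = r} (leaves⊆flat F v∈)
      ... | u , p = cong isOne (countB-one (Und T v) (E-und (inj₂ (search-parent found p))) only)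
        where
        only : ∀ {w} → Und T v w ≡ true → w ≡ u
        only e with arc-E (und⁻ e)
        ... | inj₁ out = contradiction out (leaf-no-arc v∈)
        ... | inj₂ inn = unique-parent inn (search-parent found p)
    ... | empty | _ | _ = s≤s z≤n
    ... | node _ _ _ | uniq | deg = m≤n⇒m≤1+n (unique-countB (λ u → isOne (degree T u)) uniq deg)

    realise : ∀ {V : Set} {R : V → V → Set} {κ x Ok} → Spans κ → Embedding R κ x Ok →
              ∃[ g ] ((∀ {u v} → g u ≡ g v → u ≡ v) × (∀ {u v} → E u v → R (g u) (g v)))
    realise {V} {R} {κ} spans emb = g , injective-g , arcs-g
      where
      open Spans spans
      open Embedding emb using (ψ; keys; injective) renaming (arcs to ψ-arcs)
      once : ∀ {B : Set} {f : Fin m × V → B} {ps p p′} → Unique (map f ps) → p ∈ ps → p′ ∈ ps → f p ≡ f p′ → p ≡ p′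
      once (a ∷ u) (here refl) (here refl) eq = refl
      once {f = f} (a ∷ u) (here refl) (there p∈) eq = contradiction eq (All.lookup a (∈-map⁺ f p∈))
      once {f = f} (a ∷ u) (there p∈) (here refl) eq = contradiction (sym eq) (All.lookup a (∈-map⁺ f p∈))
      once (a ∷ u) (there p∈) (there p∈′) eq = once u p∈ p∈′ eq
      image : ∀ u → ∃[ a ] (u , a) ∈ ψ
      image u with ∈-map⁻ proj₁ (subst (u ∈_) (sym keys) (everywhere u))
      ... | (_ , a) , p∈ , refl = a , p∈
      g : Fin m → V
      g u = proj₁ (image u)
      g-unique : ∀ {u a} → (u , a) ∈ ψ → g u ≡ a
      g-unique {u} p∈ = cong proj₂ (once (subst Unique (sym keys) distinct) (proj₂ (image u)) p∈ refl)
      injective-g : ∀ {u v} → g u ≡ g v → u ≡ v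
      injective-g {u} {v} eq = cong proj₁ (once injective (proj₂ (image u)) (proj₂ (image v)) eq)
      arcs-g : ∀ {u v} → E u v → R (g u) (g v)
      arcs-g e with ψ-arcs (arcs e)
      ... | a , b , a∈ , b∈ , rel = subst₂ R (sym (g-unique a∈)) (sym (g-unique b∈)) rel

    search-host : ∀ {N} (Bl Rd : Fin N → Fin N → Set) → Decidable₂ Bl → Decidable₂ Rd →
      (∀ {u v} → u ≢ v → (Bl u v ⊎ Bl v u) ⊎ (Rd u v ⊎ Rd v u)) → (k : ℕ) → 1 ≤ k →
      (∀ {xs ys} → Unique xs → Unique ys → Disjointₗ xs ys → k ≤ length xs → k ≤ length ys →
        ∃[ x ] ∃[ y ] (x ∈ xs × y ∈ ys × (Bl x y ⊎ Rd x y))) →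
      ∀ n → n * 2048 ≤ N → m * 2048 ≤ N → m * n * k * 1048576 ≤ N * N → k * suc (leaves T) * 4096 ≤ N →
      Path Bl n ⊎ ∃[ g ] ((∀ {u v} → g u ≡ g v → u ≡ v) × (∀ {u v} → E u v → Rd (g u) (g v)))
    search-host {N} Bl Rd Bl? Rd? total k 1≤k joined n small-n small-m small-nm small-λ = result (chunks ℓ 1≤ℓ)
      where
      open Host Fin._≟_ Bl Rd Bl? Rd? total k 1≤k joined
      open Parameters N k n m (suc (leaves T)) 1≤k (s≤s z≤n) small-n small-m small-nm small-λ
      result : ∃[ κ ] (Spans κ × Short ℓ κ × ℓ * cost κ ≤ 2 * (length (allFin m) + 2 * (ℓ * length (tips r F)))) → _
      result (κ , spans , short , cheap) = Sum.map id (λ (x , emb) → realise spans emb)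
        (pathOrTree (Uniqueₚ.allFin⁺ N) n ℓ w (22 * k) t
          ℓ≤2k (s≤s z≤n) wℓ≤2k (sizes-fit w≤2k) (subst (t * (22 * k) ≤_) (sym (size N)) fits) κ short
          (λ {j} → few-classes {cost κ} (4q≤t (≤-trans cheap cheaper)) {j}))
        where
        size : ∀ x → length (allFin x) ≡ x
        size x = length-tabulate {n = x} id
        cheaper : 2 * (length (allFin m) + 2 * (ℓ * length (tips r F))) ≤ 2 * (m + 2 * (ℓ * suc (leaves T)))
        cheaper = *-monoʳ-≤ 2 (+-mono-≤ {length (allFin m)} {m} (≤-reflexive (size m)) (*-monoʳ-≤ 2 (*-monoʳ-≤ ℓ few-tips)))

pathCopy : ∀ {N} {G : Digraph N} {col χ n} → Path (λ u v → G u v ≡ true × col u v ≡ χ) n → PathCopy G col χ n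
pathCopy (p , refl , link , u) = lookup p , lookup-injective u _ _ , lookup-linked link

-- The power inequality states nmc² log N ≤ N² without logarithms; with 2^e ≤ N it yields e·nmc² ≤
-- N². The rest is e + 1 ≤ 2e and 2pd ≤ c ≤ c².
product-bound : ∀ {N n m c d p e} → p * (2 * d) ≤ c → 1 ≤ c → 1 ≤ e → 2 ^ e ≤ N → N ^ (n * m * c * c) ≤ 2 ^ (N * N) →
  m * n * (p * suc e) * d ≤ N * N
product-bound {N} {n} {m} {c} {d} {p} {e} pd≤c 1≤c 1≤e lo pow = begin
  m * n * (p * suc e) * d       ≤⟨ *-monoˡ-≤ d (*-monoʳ-≤ (m * n) (*-monoʳ-≤ p (+-mono-≤ 1≤e (≤-reflexive (sym (+-identityʳ e)))))) ⟩
  m * n * (p * (2 * e)) * d     ≡⟨ eq d m n p e ⟩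
  p * (2 * d) * (m * n * e)     ≤⟨ *-monoˡ-≤ (m * n * e) pd≤c ⟩
  c * (m * n * e)               ≤⟨ *-monoˡ-≤ (m * n * e) (m≤m*n c c {{>-nonZero 1≤c}}) ⟩
  c * c * (m * n * e)           ≡⟨ eq′ c m n e ⟩
  e * (n * m * c * c)           ≤⟨ 2^-cancel-≤ (≤-trans (≤-reflexive (sym (^-*-assoc 2 e (n * m * c * c)))) (≤-trans (^-monoˡ-≤ (n * m * c * c) lo) pow)) ⟩
  N * N                         ∎
  where
  open ≤-Reasoning
  eq : ∀ d m n p e → m * n * (p * (2 * e)) * d ≡ p * (2 * d) * (m * n * e)
  eq = solve-∀
  eq′ : ∀ c m n e → c * c * (m * n * e) ≡ e * (n * m * c * c)
  eq′ = solve-∀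

-- u, d and f stand for the constants 2048, 2²⁰ and 4096 of Parameters, and k is p (e + 1); with the
-- numerals themselves, multiplication would unfold.
sizes : ∀ {N n m l c p u d f} → 1 ≤ p → 1 ≤ m → 1 ≤ N → 1 ≤ f → u ≤ c → p * (2 * d) ≤ c → 2 ^ (p * f * 16) ≤ c →
  n * c ≤ N → m * c ≤ N → N ^ (n * m * c * c) ≤ 2 ^ (N * N) → l ^ 6 ≤ m →
  ∃[ e ] (N ≤ 2 ^ suc e × n * u ≤ N × m * u ≤ N × m * n * (p * suc e) * d ≤ N * N × p * suc e * suc l * f ≤ N)
sizes {N} {n} {m} {l} {c} {p} {u} {d} {f} 1≤p 1≤m 1≤N 1≤f u≤c pd≤c c₂ nc mc pow leaf with log₂ N 1≤N
... | e , lo , hi = e , <⇒≤ hi , ≤-trans (*-monoʳ-≤ n u≤c) nc , ≤-trans (*-monoʳ-≤ m u≤c) mc ,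
  product-bound {n = n} {m} {c} {d} {p} pd≤c 1≤c 1≤e lo pow ,
  ≤-trans (≤-reflexive (eq f p (suc e) (suc l))) (leaf-bound (p * f) e N l 1≤pf (≤-trans (≤-reflexive (*-comm 16 (p * f))) 16pf≤e) lo (≤-trans leaf m≤N))
  where
  1≤c : 1 ≤ c
  1≤c = ≤-trans (m^n>0 2 (p * f * 16)) c₂
  c≤N : c ≤ N
  c≤N = ≤-trans (m≤n*m c m {{>-nonZero 1≤m}}) mc
  m≤N : m ≤ N
  m≤N = ≤-trans (m≤m*n m c {{>-nonZero 1≤c}}) mc
  1≤pf : 1 ≤ p * f
  1≤pf = *-mono-≤ 1≤p 1≤f
  16pf≤e : p * f * 16 ≤ e
  -- The lower bound on `c` forces `N`, and with it `e`, to be large: 2^(16pf) ≤ c ≤ N < 2^(e + 1).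
  16pf≤e = s≤s⁻¹ (≰⇒> λ le → <⇒≱ hi (≤-trans (^-monoʳ-≤ 2 le) (≤-trans c₂ c≤N)))
  1≤e : 1 ≤ e
  1≤e = ≤-trans 1≤pf (≤-trans (m≤m*n (p * f) 16) 16pf≤e)
  eq : ∀ d p y s → p * y * s * d ≡ p * d * y * s
  eq = solve-∀

-- The coloured pseudorandom tournament

xor-true : ∀ x y → (x xor y) ≡ true → x ≡ true ⊎ y ≡ true
xor-true true _ _ = inj₁ refl
xor-true false true _ = inj₂ refl

numerator-positive : ∀ σ → 0ℚ <ℚ σ → 1 ≤ ∣ ↥ σ ∣
numerator-positive σ 0<σ with σ | positive 0<σ
... | mkℚ +[1+ _ ] _ _ | _ = s≤s z≤n

density-positive : ∀ ε a b → 0ℚ <ℚ ε → 1 ≤ a → ε *ℚ ℕtoℚ a ≤ℚ ℕtoℚ b → 1 ≤ b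
density-positive ε (suc a) (suc b) _ _ _ = s≤s z≤n
density-positive ε (suc a) zero 0<ε _ le = contradiction (ℚₚ.<-≤-trans (ℚₚ.positive⁻¹ (ε *ℚ ℕtoℚ (suc a))
  {{ℚₚ.pos*pos⇒pos ε {{positive 0<ε}} (ℕtoℚ (suc a)) {{ℚₚ.normalize-pos (suc a) 1}}}}) le) (ℚₚ.<-irrefl refl)

module Dense {N : ℕ} (G : Digraph N) {ε σ : ℚ} (0<ε : 0ℚ <ℚ ε) (pseudo : Pseudorandom ε σ G)
  (k : ℕ) (1≤k : 1 ≤ k) (long : ∀ a → k ≤ a → AtLeastσLog σ N a) where

  arcBetween : ∀ {xs ys} → Unique xs → Unique ys → Disjointₗ xs ys → k ≤ length xs → k ≤ length ys →
               ∃[ x ] ∃[ y ] (x ∈ xs × y ∈ ys × G x y ≡ true)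
  arcBetween {xs} {ys} ux uy dis lx ly =
    let a , b , pa , pb , g = eDir-edge G (has xs) (has ys) (density-positive ε _ _ 0<ε
          (*-mono-≤ (≤-trans 1≤k (size ux lx)) (≤-trans 1≤k (size uy ly)))
          (pseudo (has xs) (has ys) apart (long _ (size ux lx)) (long _ (size uy ly))))
    in a , b , sound xs pa , sound ys pb , g
    where
    in? : ∀ v (zs : List (Fin N)) → Dec (v ∈ zs)
    in? v zs = Any.any? (v Fin.≟_) zs
    has : List (Fin N) → Fin N → Bool
    has zs v = does (in? v zs)
    sound : ∀ zs {v} → has zs v ≡ true → v ∈ zs
    sound zs {v} eq with in? v zs
    ... | yes p = p
    complete : ∀ {zs v} → v ∈ zs → has zs v ≡ true
    complete {zs} {v} v∈ = dec-true (in? v zs) v∈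
    size : ∀ {zs} → Unique zs → k ≤ length zs → k ≤ countB (has zs)
    size {zs} u le = ≤-trans le (unique-countB (has zs) u complete)
    apart : Disjoint (has xs) (has ys)
    apart v with has xs v in eqx | has ys v in eqy
    ... | true | true = contradiction (sound xs eqx , sound ys eqy) dis
    ... | true | false = refl
    ... | false | _ = refl

arrows : {ε σ : ℚ} → 0ℚ <ℚ ε → 0ℚ <ℚ σ → (c : ℕ) → 2048 ≤ c → ∣ ↥ σ ∣ * 2097152 ≤ c → 2 ^ (∣ ↥ σ ∣ * 4096 * 16) ≤ c →
  (N : ℕ) (G : Digraph N) → 1 ≤ N → IsTournament G → Pseudorandom ε σ G →
  (n m : ℕ) (T : Digraph m) → IsDirectedTree T → leaves T ^ 6 ≤ m →
  n * c ≤ N → m * c ≤ N → N ^ (n * m * c * c) ≤ 2 ^ (N * N) → Arrows G n T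
arrows {ε} {σ} 0<ε 0<σ c 2048≤c 2^21p≤c 2^16P≤c N G 1≤N (_ , tournament) pseudo n m T ((1≤m , oriented , _ , no-cycle) , r , reach) few-leaves nc mc pow col =
  finish (sizes {n = n} {m} {leaves T} {c} {p} {2048} {1048576} {4096} (numerator-positive σ 0<σ) 1≤m 1≤N (s≤s z≤n)
  2048≤c 2^21p≤c 2^16P≤c nc mc pow few-leaves)
  where
  p : ℕ
  p = ∣ ↥ σ ∣
  Coloured : Colour → Fin N → Fin N → Set
  Coloured χ u v = G u v ≡ true × col u v ≡ χ
  coloured? : ∀ χ → Decidable₂ (Coloured χ)
  coloured? χ u v = true? (G u v) ×-dec colour? (col u v) χ
    where
    colour? : DecidableEquality Colour
    colour? red red = yes refl
    colour? red blue = no λ ()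
    colour? blue red = no λ ()
    colour? blue blue = yes refl
  colour : ∀ {u v} → G u v ≡ true → Coloured blue u v ⊎ Coloured red u v
  colour {u} {v} g with col u v
  ... | red = inj₂ (g , refl)
  ... | blue = inj₁ (g , refl)
  total : ∀ {u v} → u ≢ v → (Coloured blue u v ⊎ Coloured blue v u) ⊎ (Coloured red u v ⊎ Coloured red v u)
  total {u} {v} ne = [ Sum.map inj₁ inj₁ ∘ colour , Sum.map inj₂ inj₂ ∘ colour ]′ (xor-true (G u v) (G v u) (tournament u v ne))
  open Tree T oriented no-cycle
  open SimplePaths (Fin._≟_ {m})
  finish : ∃[ e ] (N ≤ 2 ^ suc e × n * 2048 ≤ N × m * 2048 ≤ N × m * n * (p * suc e) * 1048576 ≤ N * N ×
             p * suc e * suc (leaves T) * 4096 ≤ N) → PathCopy G col blue n ⊎ Copy G col red T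
  finish (e , N≤ , small-n , small-m , small-nm , small-λ) = [ outward , inward ]′ reach
    where
    -- As `p` is the numerator of `σ`, it is at least `σ`, and e + 1 is at least log N; so `k` is at
    -- least σ log N.
    k : ℕ
    k = p * suc e
    1≤k : 1 ≤ k
    1≤k = *-mono-≤ (numerator-positive σ 0<σ) (s≤s (z≤n {e}))
    long : ∀ a → k ≤ a → AtLeastσLog σ N a
    long a k≤a = ≤-trans (^-monoˡ-≤ p N≤) (≤-trans (≤-reflexive (^-*-assoc 2 (suc e) p))
      (^-monoʳ-≤ 2 (≤-trans (≤-trans (≤-reflexive (*-comm (suc e) p)) k≤a) (m≤n*m a (↧ₙ σ)))))
    open Dense G {σ = σ} 0<ε pseudo k 1≤k long
    outward : ((v : Fin m) → DWalk T r v) → PathCopy G col blue n ⊎ Copy G col red T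
    outward walk = Sum.map pathCopy (λ (g , inj , arcs) → g , inj , λ _ _ → arcs)
      (search-host (Coloured blue) (Coloured red) (coloured? blue) (coloured? red) total k 1≤k
        (λ ux uy dis lx ly → let x , y , x∈ , y∈ , g = arcBetween ux uy dis lx ly in x , y , x∈ , y∈ , colour g)
        n small-n small-m small-nm small-λ)
      where open Directed arc (λ u v → true? (T u v)) inj₁ id arc-irreflexive arc-asymmetric r (λ v → walk-simple (walk v))
    inward : ((v : Fin m) → DWalk T v r) → PathCopy G col blue n ⊎ Copy G col red T
    -- Reversing all arcs makes the tree lead away from `r`. Both colours are reversed with it,
    -- `arcBetween` gets its sets in exchanged order, and the blue path is turned round at the end.
    inward walk = Sum.map (pathCopy ∘ reversePath) (λ (g , inj , arcs) → g , inj , λ _ _ → arcs)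
      (search-host (flip (Coloured blue)) (flip (Coloured red)) (flip (coloured? blue)) (flip (coloured? red))
        (λ ne → total (ne ∘ sym)) k 1≤k
        (λ ux uy dis lx ly → let y , x , y∈ , x∈ , g = arcBetween uy ux (λ (a , b) → dis (b , a)) ly lx in x , y , x∈ , y∈ , colour g)
        n small-n small-m small-nm small-λ)
      where open Directed (flip arc) (λ u v → true? (T v u)) inj₂ Sum.swap arc-irreflexive (λ e e′ → arc-asymmetric e e′) r
              (λ v → backwards id (walk-simple (walk v)) ([] , [-] , ([] ∷ []) , refl , (tt ∷ [])))

theorem4p7 : (ε σ : ℚ) → 0ℚ <ℚ ε → ε <ℚ ½ → 0ℚ <ℚ σ →
    ∃[ c ] (1 ≤ c ×
    ((N : ℕ) (G : Digraph N) → 1 ≤ N → IsTournament G → Pseudorandom ε σ G →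
    (n m : ℕ) (T : Digraph m) → IsDirectedTree T → leaves T ^ 6 ≤ m →
    n * c ≤ N → m * c ≤ N → N ^ (n * m * c * c) ≤ 2 ^ (N * N) →
    Arrows G n T))
-- The first summand is 2p·2²⁰, as `product-bound` asks, and is at least 2048; the second makes log
-- N large enough for `leaf-bound`.
theorem4p7 ε σ 0<ε _ 0<σ = p * 2097152 + 2 ^ (p * 4096 * 16) ,
  ≤-trans (s≤s z≤n) 2048≤c , arrows 0<ε 0<σ _ 2048≤c (m≤m+n _ _) (m≤n+m _ (p * 2097152))
  where
  p : ℕ
  p = ∣ ↥ σ ∣
  2048≤c : 2048 ≤ p * 2097152 + 2 ^ (p * 4096 * 16)
  2048≤c = ≤-trans (≤-trans (m≤m+n 2048 2095104) (m≤n*m 2097152 p {{>-nonZero (numerator-positive σ 0<σ)}})) (m≤m+n _ _)
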